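{- Let $u$ and $v$ be two words of the same length with the same Parikh vector. Suppose that either (a) all symbols of $u$ are pairwise distinct, or (b) $u$ and $v$ are over a binary alphabet. Then $v$ can be obtained from $u$ by applying a finite sequence of operations, each of which is either $\mathit{rot}$ or $\mathsf{BBWT}$.
   Context: Strings are over a totally ordered alphabet. The Parikh vector of a word records the number of occurrences of each symbol. $\mathit{rot}(x)=x[|x|]\,x[1..|x|-1]$. A Lyndon word is a nonempty string strictly lexicographically smaller than all its proper nonempty suffixes. Every string has a unique Lyndon factorization $w=u_1\cdots u_m$ into Lyndon words with $u_1\succeq\cdots\succeq u_m$. For primitive $x,y$, $x\prec_\omega y$ iff $x^\infty\prec y^\infty$ lexicographically. $\mathsf{BBWT}(w)$ is obtained as follows: take the multiset of all cyclic rotations of all Lyndon factors $u_j$ (each contributing its $|u_j|$ rotations), sort it in $\omega$-order, and concatenate the last characters. -}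

module Defs where

open import Level using (0ℓ)
open import Data.Nat using (ℕ; zero; suc; _<_; NonZero)
open import Data.Nat.DivMod using (_%_; m%n<n)
open import Data.Fin using (fromℕ<)
open import Data.List using (List; []; _∷_; _++_; _∷ʳ_; length; reverse; filter; lookup; concatMap)
open import Data.List.Relation.Binary.Permutation.Propositional using (_↭_)
open import Data.List.Relation.Binary.Pointwise using (Pointwise)
open import Data.List.Relation.Unary.All using (All)
open import Data.List.Relation.Unary.AllPairs using (AllPairs)
open import Data.List.Relation.Unary.Linked using (Linked)
open import Data.Product using (Σ; ∃; _×_)
open import Data.Sum using (_⊎_)
open import Data.Empty using (⊥)
open import Relation.Nullary using (¬_)
open import Relation.Binary using (Rel; IsStrictTotalOrder)
open import Relation.Binary.PropositionalEquality using (_≡_; _≢_)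
open import Relation.Binary.Construct.Closure.ReflexiveTransitive using (Star)

module Words (A : Set) (_⊏_ : Rel A 0ℓ) (sto : IsStrictTotalOrder _≡_ _⊏_) where

  open IsStrictTotalOrder sto using (_≟_)

  Word : Set
  Word = List A

  count : A → Word → ℕ
  count a w = length (filter (_≟ a) w)

  SameParikh : Word → Word → Set
  SameParikh u v = ∀ a → count a u ≡ count a v

  rot : Word → Word
  rot w with reverse w
  ... | []    = []
  ... | c ∷ r = c ∷ reverse r

  data _≺_ : Word → Word → Set where
    []≺∷  : ∀ {y ys} → [] ≺ (y ∷ ys)
    head≺ : ∀ {x y xs ys} → x ⊏ y → (x ∷ xs) ≺ (y ∷ ys)
    tail≺ : ∀ {x xs ys} → xs ≺ ys → (x ∷ xs) ≺ (x ∷ ys)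

  _⪯_ : Word → Word → Set
  x ⪯ y = x ≺ y ⊎ x ≡ y

  Lyndon : Word → Set
  Lyndon w = w ≢ [] × (∀ p s → w ≡ p ++ s → p ≢ [] → s ≢ [] → w ≺ s)

  IsLyndonFactorization : List Word → Word → Set
  IsLyndonFactorization us w =
    All Lyndon us × (Data.List.concat us ≡ w) × Linked (λ a b → b ⪯ a) us

  pow∞ : A → Word → ℕ → A
  pow∞ a as i = lookup (a ∷ as) (fromℕ< (m%n<n i (length (a ∷ as))))

  _≺ω_ : Word → Word → Set
  []       ≺ω _        = ⊥
  (_ ∷ _)  ≺ω []       = ⊥
  (a ∷ as) ≺ω (b ∷ bs) =
    ∃ λ k → (∀ i → i < k → pow∞ a as i ≡ pow∞ b bs i) × (pow∞ a as k ⊏ pow∞ b bs k)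

  rotationsN : ℕ → Word → List Word
  rotationsN zero    _ = []
  rotationsN (suc n) x = x ∷ rotationsN n (rot x)

  rotations : Word → List Word
  rotations u = rotationsN (length u) u

  ωSorted : List Word → Set
  ωSorted L = AllPairs (λ x y → ¬ (y ≺ω x)) L

  -- b = BBWT(w): sort the multiset of all rotations of all Lyndon factors of w
  -- in ω-order and concatenate the last characters.
  IsBBWT : Word → Word → Set
  IsBBWT w b =
    Σ (List Word) λ us → IsLyndonFactorization us w ×
    Σ (List Word) λ L → (L ↭ concatMap rotations us) × ωSorted L ×
    Pointwise (λ c r → ∃ λ p → r ≡ p ∷ʳ c) b L

  Step : Word → Word → Set
  Step u v = v ≡ rot u ⊎ IsBBWT u v

  Reachable : Word → Word → Set
  Reachable = Star Step

{-# OPTIONS --safe #-}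
module Submission where

-- Write F for the word z with its letters sorted. The BBWT is inverted as by Gessel and Reutenauer: the cycles of the
-- stable sorting permutation of z spell the Lyndon factors of a word invert z with BBWT(invert z) = z. As the BBWT is
-- deterministic, invert is injective; being a permutation of the finitely many rearrangements of z, like rot, it has
-- finite order, so reachability is symmetric. Now suppose that z = x s t, where s is a prefix of F and x exceeds all
-- letters of s. Then the i-th letter of s sits at position i + 1 and has rank i, so the smallest rotation, which is the
-- last factor of invert z, starts with the first |s| + 1 letters of F. Thus, after a rotation, a longer prefix of F can
-- be split off, until all of F is reached. If z has pairwise distinct letters, the letter x cyclically before s always
-- exceeds s; if z is binary and it does not, then either x s is again a prefix of F or s t is already sorted.

open import Defs
open import Level using (0ℓ)
open import Data.Empty using (⊥; ⊥-elim)
open import Data.Fin as Fin using (Fin; zero; suc; toℕ; fromℕ<; cast; funToFin; finToFun)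
import Data.Fin.Induction as FinInd
import Data.Fin.Properties as Finₚ
open import Data.List using (List; []; _∷_; _++_; _∷ʳ_; [_]; _∷ʳ′_; initLast; map; concat; concatMap; applyUpTo; allFin; filter; reverse; length; lookup; last)
open import Data.List.Membership.Propositional using (_∈_; find)
import Data.List.Membership.Propositional.Properties as ∈ₚ
open import Data.List.Membership.Propositional.Properties.WithK using (unique∧set⇒bag)
import Data.List.Properties as Listₚ
open import Data.List.Relation.Binary.BagAndSetEquality using (∼bag⇒↭)
open import Data.List.Relation.Binary.Disjoint.Propositional using (Disjoint)
open import Data.List.Relation.Binary.Lex using (this; next; base)
import Data.List.Relation.Binary.Lex.Strict as LexList
import Data.List.Relation.Binary.Permutation.Homogeneous as Homogeneous
open import Data.List.Relation.Binary.Permutation.Propositional using (_↭_; ↭-refl; ↭-sym; ↭-trans; ↭-reflexive; ↭⇒↭ₛ; prep)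
import Data.List.Relation.Binary.Permutation.Propositional.Properties as ↭ₚ
import Data.List.Relation.Binary.Permutation.Setoid.Properties as ↭ₛₚ
open import Data.List.Relation.Binary.Pointwise as Pointwise using (Pointwise; []; _∷_)
open import Data.List.Relation.Unary.All as All using (All; []; _∷_; all?)
import Data.List.Relation.Unary.All.Properties as Allₚ
open import Data.List.Relation.Unary.AllPairs as AllPairs using (AllPairs; []; _∷_)
import Data.List.Relation.Unary.AllPairs.Properties as AllPairsₚ
open import Data.List.Relation.Unary.Any using (Any; here; there; any?; index)
import Data.List.Relation.Unary.Any.Properties as Anyₚ
import Data.List.Relation.Unary.Linked.Properties as Linkedₚ
import Data.List.Relation.Unary.Sorted.TotalOrder.Properties as Sortedₚ
open import Data.List.Relation.Unary.Unique.Propositional using (Unique)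
import Data.List.Relation.Unary.Unique.Propositional.Properties as Uniqueₚ
open import Data.List.Sort using (sort; sort-↭; sort-↗)
open import Data.Maybe using (just)
open import Data.Maybe.Properties using (just-injective)
open import Data.Nat as ℕ using (ℕ; zero; suc; _+_; _*_; _^_; _<_; _≤_; z≤n; s≤s; z<s; s<s; NonZero)
open import Data.Nat.DivMod using (_%_; _/_; m≡m%n+[m/n]*n; m%n<n; [m+kn]%n≡m%n; m<n⇒m%n≡m)
open import Data.Nat.Divisibility using (_∣_; divides)
open import Data.Nat.GeneralisedArithmetic using (iterate)
open import Data.Nat.ListAction using (product)
open import Data.Nat.ListAction.Properties using (∈⇒∣product; product≢0)
import Data.Nat.Properties as ℕₚ
open import Data.Product using (∃; ∃₂; _×_; _,_; proj₁; proj₂; swap)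
import Data.Product.Relation.Binary.Lex.Strict as Lex
open import Data.Sum as Sum using (_⊎_; inj₁; inj₂)
open import Data.Unit using (tt)
open import Function using (_∘_; id; mk⇔)
open import Induction.WellFounded using (Acc; acc)
open import Relation.Binary using (Rel; IsStrictTotalOrder; StrictTotalOrder; TotalOrder; DecTotalOrder; tri<; tri≈; tri>)
import Relation.Binary.Construct.On as On
open import Relation.Binary.Construct.Closure.ReflexiveTransitive using (ε; _◅_; _◅◅_)
import Relation.Binary.Properties.StrictTotalOrder as STOₚ
open import Relation.Binary.PropositionalEquality using (_≡_; _≢_; refl; sym; trans; cong; cong₂; subst; subst₂; setoid; module ≡-Reasoning)
open import Relation.Nullary using (¬_; yes; no; contradiction)
open import Relation.Unary using (Pred; Decidable)

-- Iteration and periodic orbits of injective maps.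

private variable X : Set

iterate-+ : (f : X → X) (x : X) (m k : ℕ) → iterate f x (m + k) ≡ iterate f (iterate f x m) k
iterate-+ f x zero    k = refl
iterate-+ f x (suc m) k = iterate-+ f (f x) m k

iterate-suc : (f : X → X) (x : X) (k : ℕ) → iterate f x (suc k) ≡ f (iterate f x k)
iterate-suc f x zero    = refl
iterate-suc f x (suc k) = iterate-suc f (f x) k

iterate-* : (f : X → X) {x : X} {d : ℕ} → iterate f x d ≡ x → (k : ℕ) → iterate f x (k * d) ≡ x
iterate-* f         eq zero    = refl
iterate-* f {x} {d} eq (suc k) =
  trans (iterate-+ f x d (k * d)) (trans (cong (λ y → iterate f y (k * d)) eq) (iterate-* f eq k))

iterate-injective : {f : X → X} → (∀ {x y} → f x ≡ f y → x ≡ y) →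
  (k : ℕ) {x y : X} → iterate f x k ≡ iterate f y k → x ≡ y
iterate-injective inj zero    eq = eq
iterate-injective inj (suc k) eq = inj (iterate-injective inj k eq)

-- By the pigeonhole principle two of the first `N + 1` iterates share a code; injectivity cancels
-- the smaller exponent. Only the orbit has to be encoded, so `X` itself may be infinite.
orbit-periodic : {f : X → X} → (∀ {x y} → f x ≡ f y → x ≡ y) → (x : X) {N : ℕ} (c : ℕ → Fin N) →
  (∀ i j → c i ≡ c j → iterate f x i ≡ iterate f x j) → ∃ λ d → iterate f x (suc d) ≡ x
orbit-periodic {f = f} inj x {N} c faithful
  with Finₚ.pigeonhole (ℕₚ.n<1+n N) (c ∘ toℕ)
... | i , j , i<j , ci≡cj with ℕₚ.m≤n⇒∃[o]m+o≡n i<j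
...   | d , 1+i+d≡j = d , iterate-injective inj (toℕ i) (begin
  iterate f (iterate f x (suc d)) (toℕ i)  ≡⟨ iterate-+ f x (suc d) (toℕ i) ⟨
  iterate f x (suc d + toℕ i)              ≡⟨ cong (iterate f x) (trans (cong suc (ℕₚ.+-comm d (toℕ i))) 1+i+d≡j) ⟩
  iterate f x (toℕ j)                      ≡⟨ faithful _ _ ci≡cj ⟨
  iterate f x (toℕ i)                      ∎)
  where open ≡-Reasoning

least : {P : ℕ → Set} → Decidable P → (n : ℕ) → P n → ∃ λ m → P m × (∀ {j} → j < m → ¬ P j)
least P? zero    pn = zero , pn , λ ()
least P? (suc n) pn with P? zero
... | yes p0 = zero , p0 , λ ()
... | no ¬p0 with least (P? ∘ suc) n pn
...   | m , pm , below = suc m , pm , λ { {zero} _ → ¬p0 ; {suc j} (s<s j<m) → below j<m }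

∈-applyUpTo : {f : ℕ → X} {y : X} (n : ℕ) → y ∈ applyUpTo f n → ∃ λ i → i < n × y ≡ f i
∈-applyUpTo {f = f} n = ∈ₚ.∈-applyUpTo⁻ f

unique-set⇒↭ : {xs ys : List X} → Unique xs → Unique ys →
  (∀ {x} → x ∈ xs → x ∈ ys) → (∀ {x} → x ∈ ys → x ∈ xs) → xs ↭ ys
unique-set⇒↭ xs! ys! to from = ∼bag⇒↭ (unique∧set⇒bag xs! ys! (mk⇔ to from))

-- Cycles of a permutation of positions.

downFin : (n : ℕ) → List (Fin n)
downFin zero    = []
downFin (suc n) = map suc (downFin n) ∷ʳ zero

∈-downFin : ∀ {n} (x : Fin n) → x ∈ downFin n
∈-downFin zero    = ∈ₚ.∈-++⁺ʳ _ (here refl)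
∈-downFin (suc x) = ∈ₚ.∈-++⁺ˡ (∈ₚ.∈-map⁺ suc (∈-downFin x))

downFin-descending : ∀ n → AllPairs Fin._>_ (downFin n)
downFin-descending zero    = []
downFin-descending (suc n) =
  AllPairsₚ.++⁺ (AllPairsₚ.map⁺ (AllPairs.map s<s (downFin-descending n))) ([] ∷ [])
    (Allₚ.map⁺ (All.universal (λ _ → z<s ∷ []) _))

module Cycles {n : ℕ} (σ π : Fin n → Fin n) (σπ : ∀ x → σ (π x) ≡ x) (πσ : ∀ x → π (σ x) ≡ x) where

  σ^ : ℕ → Fin n → Fin n
  σ^ k x = iterate σ x k

  σ-injective : ∀ {x y} → σ x ≡ σ y → x ≡ y
  σ-injective {x} {y} eq = trans (sym (πσ x)) (trans (cong π eq) (πσ y))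

  module _ (x : Fin n) where
    private abstract
      returns : ∃ λ m → σ^ (suc m) x ≡ x × (∀ {j} → j < m → σ^ (suc j) x ≢ x)
      returns with orbit-periodic σ-injective x (λ i → σ^ i x) (λ _ _ eq → eq)
      ... | d , eq = least (λ m → σ^ (suc m) x Finₚ.≟ x) d eq

    -- One less than the length of the cycle through x.
    period-1 : ℕ
    period-1 = proj₁ returns

    period : ℕ
    period = suc period-1

    σ^period : σ^ period x ≡ x
    σ^period = proj₁ (proj₂ returns)

    period-least : ∀ {j} → j < period-1 → σ^ (suc j) x ≢ x
    period-least = proj₂ (proj₂ returns)

  period-minimal : ∀ x m → σ^ (suc m) x ≡ x → period-1 x ≤ m
  period-minimal x m eq = ℕₚ.≮⇒≥ λ m<p → period-least x m<p eq

  σ^-suc : ∀ k x → σ^ (suc k) x ≡ σ (σ^ k x)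
  σ^-suc k x = iterate-suc σ x k

  period-σ : ∀ x → period-1 (σ x) ≡ period-1 x
  period-σ x = ℕₚ.≤-antisym
    (period-minimal (σ x) _ (trans (σ^-suc (period x) x) (cong σ (σ^period x))))
    (period-minimal x _ (σ-injective (trans (sym (σ^-suc (period (σ x)) x)) (σ^period (σ x)))))

  period-π : ∀ x → period-1 (π x) ≡ period-1 x
  period-π x = trans (sym (period-σ (π x))) (cong period-1 (σπ x))

  σ^-% : ∀ i x → σ^ i x ≡ σ^ (i % period x) x
  σ^-% i x = begin
    σ^ i x                                                     ≡⟨ cong (λ k → σ^ k x) (m≡m%n+[m/n]*n i (period x)) ⟩
    σ^ (i % period x + (i / period x) * period x) x            ≡⟨ cong (λ k → σ^ k x) (ℕₚ.+-comm (i % period x) _) ⟩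
    σ^ ((i / period x) * period x + i % period x) x            ≡⟨ iterate-+ σ x ((i / period x) * period x) _ ⟩
    σ^ (i % period x) (σ^ ((i / period x) * period x) x)       ≡⟨ cong (σ^ (i % period x)) (iterate-* σ (σ^period x) (i / period x)) ⟩
    σ^ (i % period x) x                                        ∎
    where open ≡-Reasoning

  σ^-return : ∀ i x → ∃ λ j → σ^ j (σ^ i x) ≡ x
  -- Together with the `i` steps already made, these complete `i` full periods.
  σ^-return i x = i * period-1 x , trans (sym (iterate-+ σ x i _))
    (trans (cong (λ k → σ^ k x) (sym (ℕₚ.*-suc i (period-1 x)))) (iterate-* σ (σ^period x) i))

  cycle : Fin n → List (Fin n)
  cycle x = applyUpTo (iterate σ x) (period x)

  cycle-unique : ∀ x → Unique (cycle x)
  cycle-unique x = Uniqueₚ.applyUpTo⁺₁ _ _ λ {i} {j} i<j j<d eq →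
    let (k , 1+i+k≡j) = ℕₚ.m≤n⇒∃[o]m+o≡n i<j in
    period-least x {k}
      (ℕₚ.<-≤-trans (ℕₚ.m<n+m k z<s) (ℕₚ.≤-pred (subst (_< period x) (sym 1+i+k≡j) j<d)))
      (iterate-injective σ-injective i (trans (sym (iterate-+ σ x (suc k) i))
        (trans (cong (λ m → σ^ m x) (trans (cong suc (ℕₚ.+-comm k i)) 1+i+k≡j)) (sym eq))))

  -- Each cycle is represented by its least position: a word that is read off from there is Lyndon.
  Minimum : Pred (Fin n) _
  Minimum x = All (x Fin.≤_) (cycle x)

  minimum? : Decidable Minimum
  minimum? x = all? (x Finₚ.≤?_) (cycle x)

  minimum-≤ : ∀ {x} → Minimum x → ∀ i → x Fin.≤ σ^ i x
  minimum-≤ {x} min i = subst (x Fin.≤_) (sym (σ^-% i x))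
    (Allₚ.applyUpTo⁻ (iterate σ x) (period x) min (m%n<n i (period x)))

  minimum-< : ∀ {x} → Minimum x → ∀ {i} → 0 < i → i < period x → x Fin.< σ^ i x
  minimum-< {x} min {suc i} _ (s≤s i<p) =
    Finₚ.≤∧≢⇒< (minimum-≤ min (suc i)) (period-least x i<p ∘ sym)

  -- Well-founded descent: if `y` is not least, its cycle contains a smaller `z`; the recursion
  -- treats `z`, and going on around the cycle leads back to `y`.
  reachesMinimum : ∀ y → Acc Fin._<_ y → ∃₂ λ x i → Minimum x × y ≡ σ^ i x
  reachesMinimum y (acc rec) with minimum? y
  ... | yes min = y , 0 , min , refl
  ... | no ¬min with Allₚ.¬All⇒Any¬ (y Finₚ.≤?_) (cycle y) ¬min
  ...   | smaller with find smaller
  ...     | z , z∈cycle , y≰z with ∈-applyUpTo {f = iterate σ y} (period y) z∈cycle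
  ...       | i , _ , refl with reachesMinimum z (rec (ℕₚ.≰⇒> y≰z)) | σ^-return i y
  ...         | x , j , min , z≡ | k , back =
    x , j + k , min , trans (sym back) (trans (cong (σ^ k) z≡) (sym (iterate-+ σ x j k)))

  -- The descending order becomes the nonincreasing order of the Lyndon factors.
  minima : List (Fin n)
  minima = filter minimum? (downFin n)

  minima-all : All Minimum minima
  minima-all = Allₚ.all-filter minimum? (downFin n)

  minima-descending : AllPairs Fin._>_ minima
  minima-descending = AllPairsₚ.filter⁺ minimum? (downFin-descending n)

  ∈-minima : ∀ {x} → Minimum x → x ∈ minima
  ∈-minima min = ∈ₚ.∈-filter⁺ minimum? (∈-downFin _) min

  ∈-cycle : ∀ i x → σ^ i x ∈ cycle x
  ∈-cycle i x = subst (_∈ cycle x) (sym (σ^-% i x)) (∈ₚ.∈-applyUpTo⁺ (iterate σ x) (m%n<n i (period x)))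

  -- From the shared `z` the cycle continues to `y`, so `y` lies on the cycle of `x`. Two different
  -- minima therefore have disjoint cycles.
  minimum-common : ∀ {x y z} → Minimum x → z ∈ cycle x → z ∈ cycle y → x Fin.≤ y
  minimum-common {x} {y} min z∈x z∈y
    with ∈-applyUpTo {f = iterate σ x} (period x) z∈x | ∈-applyUpTo {f = iterate σ y} (period y) z∈y
  ... | i , _ , refl | j , _ , σ^ix≡σ^jy with σ^-return j y
  ...   | k , back = subst (x Fin.≤_)
    (trans (iterate-+ σ x i k) (trans (cong (σ^ k) σ^ix≡σ^jy) back)) (minimum-≤ min (i + k))

  cycles-disjoint : ∀ {xs} → All Minimum xs → AllPairs Fin._>_ xs → Unique (concatMap cycle xs)
  cycles-disjoint {xs} mins desc = Uniqueₚ.concat⁺ (Allₚ.map⁺ (All.universal cycle-unique xs)) (AllPairsₚ.map⁺ (go mins desc))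
    where
    go : ∀ {xs} → All Minimum xs → AllPairs Fin._>_ xs → AllPairs (λ x y → Disjoint (cycle x) (cycle y)) xs
    go []           []           = []
    go (min ∷ mins) (x> ∷ desc) =
      All.map (λ x>y {_} (z∈x , z∈y) → ℕₚ.<⇒≱ x>y (minimum-common min z∈x z∈y)) x> ∷ go mins desc

  cycles-partition : concatMap cycle minima ↭ allFin n
  cycles-partition = unique-set⇒↭ (cycles-disjoint minima-all minima-descending) (Uniqueₚ.allFin⁺ n)
    (λ _ → ∈ₚ.∈-allFin _)
    (λ {y} _ → let (x , i , min , y≡) = reachesMinimum y (FinInd.<-wellFounded y) in
      ∈ₚ.∈-concat⁺′ (subst (_∈ cycle x) (sym y≡) (∈-cycle i x)) (∈ₚ.∈-map⁺ cycle (∈-minima min)))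

  backward-orbit : ∀ d x → reverse (applyUpTo (iterate σ x) (suc d)) ≡ applyUpTo (iterate π (σ^ d x)) (suc d)
  backward-orbit zero    x = refl
  backward-orbit (suc d) x = begin
    reverse (applyUpTo (iterate σ x) (suc (suc d)))                 ≡⟨ cong reverse (Listₚ.applyUpTo-∷ʳ (iterate σ x) (suc d)) ⟨
    reverse (applyUpTo (iterate σ x) (suc d) ∷ʳ σ^ (suc d) x)       ≡⟨ Listₚ.reverse-++ (applyUpTo (iterate σ x) (suc d)) [ _ ] ⟩
    σ^ (suc d) x ∷ reverse (applyUpTo (iterate σ x) (suc d))        ≡⟨ cong (σ^ (suc d) x ∷_) (backward-orbit d x) ⟩
    σ^ (suc d) x ∷ applyUpTo (iterate π (σ^ d x)) (suc d)           ≡⟨ cong (λ y → σ^ (suc d) x ∷ applyUpTo (iterate π y) (suc d)) π-last ⟨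
    applyUpTo (iterate π (σ^ (suc d) x)) (suc (suc d))              ∎
    where
    open ≡-Reasoning
    π-last : π (σ^ (suc d) x) ≡ σ^ d x
    π-last = trans (cong π (σ^-suc d x)) (πσ _)

  -- Needed because `rot` walks along `π`. The forward orbit of `σ x` ends in `x`, so its reversal
  -- is the backward orbit of `x`.
  π-cycle-↭ : ∀ x → applyUpTo (iterate π x) (period x) ↭ cycle x
  π-cycle-↭ x = ↭-trans (↭-reflexive (sym eq)) (↭-trans (↭ₚ.↭-reverse _)
    (↭-trans (↭-reflexive (sym (Listₚ.applyUpTo-∷ʳ (iterate σ (σ x)) (period-1 x))))
    (↭-trans (↭-sym (↭ₚ.∷↭∷ʳ _ _)) (↭-reflexive (cong (_∷ applyUpTo (iterate σ (σ x)) (period-1 x)) (σ^period x))))))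
    where
    eq : reverse (applyUpTo (iterate σ (σ x)) (period x)) ≡ applyUpTo (iterate π x) (period x)
    eq = trans (backward-orbit (period-1 x) (σ x)) (cong (λ y → applyUpTo (iterate π y) (period x)) (σ^period x))

lookup-injective : {X : Set} {xs : List X} → Unique xs → ∀ {i j} → lookup xs i ≡ lookup xs j → i ≡ j
lookup-injective (_   ∷ _)   {zero}  {zero}  _  = refl
lookup-injective (x∉ ∷ _)    {zero}  {suc j} eq = contradiction eq (All.lookup x∉ (∈ₚ.∈-lookup j))
lookup-injective (x∉ ∷ _)    {suc i} {zero}  eq = contradiction (sym eq) (All.lookup x∉ (∈ₚ.∈-lookup i))
lookup-injective (_   ∷ xs!) {suc i} {suc j} eq = cong suc (lookup-injective xs! eq)

concatMap-↭ : {X Y : Set} {f g : X → List Y} → (∀ x → f x ↭ g x) → ∀ xs → concatMap f xs ↭ concatMap g xs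
concatMap-↭ f↭g []       = ↭-refl
concatMap-↭ f↭g (x ∷ xs) = ↭ₚ.++⁺ (f↭g x) (concatMap-↭ f↭g xs)

map-lookup-allFin : {X : Set} (xs : List X) → map (lookup xs) (allFin (length xs)) ≡ xs
map-lookup-allFin xs = trans (Listₚ.map-tabulate id (lookup xs)) (Listₚ.tabulate-lookup xs)

applyUpTo-lookup : {X : Set} (f : ℕ → X) (xs : List X) → (∀ i → f (toℕ i) ≡ lookup xs i) → applyUpTo f (length xs) ≡ xs
applyUpTo-lookup f []       eq = refl
applyUpTo-lookup f (x ∷ xs) eq = cong₂ _∷_ (eq zero) (applyUpTo-lookup (f ∘ suc) xs (eq ∘ suc))

-- Inverting the BBWT: words spelled by the cycles of the stable sorting permutation.

module BBWT (A : Set) (_⊏_ : Rel A 0ℓ) (sto : IsStrictTotalOrder _≡_ _⊏_) where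

  open Words A _⊏_ sto
  private module ⊏ = IsStrictTotalOrder sto

  strictTotalOrder : StrictTotalOrder 0ℓ 0ℓ 0ℓ
  strictTotalOrder = record { isStrictTotalOrder = sto }

  -- `σ x` is the position whose letter has rank `x` in the stable sort, and `π` sends a position to
  -- its rank. With `ℓ` as last column of the sorted rotations, `ℓ ∘ σ` is the first column and `π`
  -- the LF-mapping.
  record StandardPermutation {n : ℕ} (ℓ : Fin n → A) : Set where
    field
      σ π : Fin n → Fin n
      σπ  : ∀ x → σ (π x) ≡ x
      πσ  : ∀ x → π (σ x) ≡ x
      stable : ∀ {x y} → x Fin.< y → ℓ (σ x) ⊏ ℓ (σ y) ⊎ (ℓ (σ x) ≡ ℓ (σ y) × σ x Fin.< σ y)

  abstract
    standardPermutation : ∀ {n} (ℓ : Fin n → A) → StandardPermutation ℓ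
    standardPermutation {n} ℓ = record { σ = σ ; π = π ; σπ = σπ ; πσ = πσ ; stable = stable }
      where
      -- Comparing letters first and positions second makes the sort stable.
      positions : DecTotalOrder 0ℓ 0ℓ 0ℓ
      positions = On.decTotalOrder
        (STOₚ.decTotalOrder (Lex.×-strictTotalOrder strictTotalOrder (Finₚ.<-strictTotalOrder n)))
        (λ i → ℓ i , i)
      xs : List (Fin n)
      xs = sort positions (allFin n)
      xs↭ : xs ↭ allFin n
      xs↭ = sort-↭ positions (allFin n)
      xs-unique : Unique xs
      xs-unique = ↭ₛₚ.Unique-resp-↭ (setoid _) (↭⇒↭ₛ (↭-sym xs↭)) (Uniqueₚ.allFin⁺ n)
      ∈-xs : ∀ y → y ∈ xs
      ∈-xs y = ↭ₚ.∈-resp-↭ (↭-sym xs↭) (∈ₚ.∈-allFin y)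
      len : length xs ≡ n
      len = trans (↭ₚ.↭-length xs↭) (Listₚ.length-tabulate id)
      σ π : Fin n → Fin n
      σ x = lookup xs (cast (sym len) x)
      π y = cast len (index (∈-xs y))
      σπ : ∀ x → σ (π x) ≡ x
      σπ x = trans (cong (lookup xs) (Finₚ.cast-involutive (sym len) len _)) (sym (Anyₚ.lookup-index (∈-xs x)))
      σ-injective : ∀ {x y} → σ x ≡ σ y → x ≡ y
      σ-injective {x} {y} eq = Finₚ.toℕ-injective
        (trans (sym (Finₚ.toℕ-cast (sym len) x)) (trans (cong toℕ (lookup-injective xs-unique eq)) (Finₚ.toℕ-cast (sym len) y)))
      πσ : ∀ x → π (σ x) ≡ x
      πσ x = σ-injective (σπ (σ x))
      stable : ∀ {x y} → x Fin.< y → ℓ (σ x) ⊏ ℓ (σ y) ⊎ (ℓ (σ x) ≡ ℓ (σ y) × σ x Fin.< σ y)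
      stable {x} {y} x<y
        with Sortedₚ.lookup-mono-≤ (DecTotalOrder.totalOrder positions) {xs} (sort-↗ positions (allFin n))
               (subst₂ _≤_ (sym (Finₚ.toℕ-cast (sym len) x)) (sym (Finₚ.toℕ-cast (sym len) y)) (ℕₚ.<⇒≤ x<y))
      ... | inj₁ lt       = lt
      ... | inj₂ (_ , eq) = contradiction (cong toℕ (σ-injective eq)) (ℕₚ.<⇒≢ x<y)

  -- Smaller by a mismatch of letters, not by being a proper prefix; hence the relation survives any
  -- continuation of either word.
  data _≪_ : Word → Word → Set where
    head≪ : ∀ {x y xs ys} → x ⊏ y → (x ∷ xs) ≪ (y ∷ ys)
    tail≪ : ∀ {x xs ys} → xs ≪ ys → (x ∷ xs) ≪ (x ∷ ys)

  ≪-++ : ∀ {u v} s t → u ≪ v → (u ++ s) ≺ (v ++ t)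
  ≪-++ s t (head≪ lt) = head≺ lt
  ≪-++ s t (tail≪ m)  = tail≺ (≪-++ s t m)

  ≪-irrefl : ∀ {u} → ¬ u ≪ u
  ≪-irrefl (head≪ lt) = ⊏.irrefl refl lt
  ≪-irrefl (tail≪ m)  = ≪-irrefl m

  ≪-asym : ∀ {u v} → u ≪ v → ¬ v ≪ u
  ≪-asym (head≪ lt) (head≪ gt) = ⊏.asym lt gt
  ≪-asym (head≪ lt) (tail≪ _)  = ⊏.irrefl refl lt
  ≪-asym (tail≪ _)  (head≪ gt) = ⊏.irrefl refl gt
  ≪-asym (tail≪ m)  (tail≪ k)  = ≪-asym m k

  ⪯-++ : ∀ u t → u ⪯ (u ++ t)
  ⪯-++ []      []      = inj₂ refl
  ⪯-++ []      (x ∷ t) = inj₁ []≺∷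
  ⪯-++ (x ∷ u) t       = Sum.map tail≺ (cong (x ∷_)) (⪯-++ u t)

  rot-∷ʳ : ∀ w c → rot (w ∷ʳ c) ≡ c ∷ w
  rot-∷ʳ w c rewrite Listₚ.reverse-++ w [ c ] = cong (c ∷_) (Listₚ.reverse-involutive w)

  module Inverse {n : ℕ} (ℓ : Fin n → A) where

    open StandardPermutation (standardPermutation ℓ) public
    open Cycles σ π σπ πσ public

    -- The rotation of rank `x` begins with the letter of rank `x`, which is `ℓ (σ x)`; passing from
    -- `x` to `σ x` drops that letter.
    prefix : ℕ → Fin n → Word
    prefix d x = applyUpTo (λ i → ℓ (σ (σ^ i x))) d

    word : Fin n → Word
    word x = prefix (period x) x

    factors : List Word
    factors = map word minima

    prefix-+ : ∀ m k x → prefix (m + k) x ≡ prefix m x ++ prefix k (σ^ m x)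
    prefix-+ zero    k x = refl
    prefix-+ (suc m) k x = cong (ℓ (σ x) ∷_) (prefix-+ m k (σ x))

    -- If the current letters agree, stability hands the order of `x` and `y` on to `σ x` and `σ y`.
    prefix-mono : ∀ e {x y} → x Fin.< y →
      prefix e x ≪ prefix e y ⊎ (prefix e x ≡ prefix e y × σ^ e x Fin.< σ^ e y)
    prefix-mono zero    x<y = inj₂ (refl , x<y)
    prefix-mono (suc e) {x} {y} x<y with ℓ (σ y) | stable x<y
    ... | _ | inj₁ lt             = inj₁ (head≪ lt)
    ... | _ | inj₂ (refl , σx<σy) = Sum.map tail≪ (λ (eq , lt) → cong (_ ∷_) eq , lt) (prefix-mono e σx<σy)

    prefix-split : ∀ d x p s → prefix d x ≡ p ++ s → d ≡ length p + length s × s ≡ prefix (length s) (σ^ (length p) x)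
    prefix-split d x [] s eq = d≡ , trans (sym eq) (cong (λ k → prefix k x) d≡)
      where
      d≡ : d ≡ length s
      d≡ = trans (sym (Listₚ.length-applyUpTo _ d)) (cong length eq)
    prefix-split (suc d) x (c ∷ p) s eq with prefix-split d (σ x) p s (Listₚ.∷-injectiveʳ eq)
    ... | d≡ , s≡ = cong suc d≡ , s≡

    length>0 : ∀ {w : Word} → w ≢ [] → 0 < length w
    length>0 {[]}    w≢[] = contradiction refl w≢[]
    length>0 {_ ∷ _} _    = z<s

    -- A proper suffix `s` is read from a later position of the cycle, which exceeds `x`. So
    -- `prefix-mono` gives a mismatch in favour of `word x`, or equality with `σ^ (length s) x`
    -- below `x`, because `length p + length s` is a full period; minimality excludes the latter.
    word-lyndon : ∀ {x} → Minimum x → Lyndon (word x)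
    word-lyndon {x} min = (λ ()) , smaller
      where
      smaller : ∀ p s → word x ≡ p ++ s → p ≢ [] → s ≢ [] → word x ≺ s
      smaller p s eq p≢[] s≢[] with prefix-split (period x) x p s eq
      ... | d≡ , s≡ with prefix-mono (length s) (minimum-< min (length>0 p≢[])
                           (subst (length p <_) (sym d≡) (ℕₚ.m<m+n (length p) (length>0 s≢[]))))
      ...   | inj₁ m = subst₂ _≺_ word≡ (trans (Listₚ.++-identityʳ _) (sym s≡)) (≪-++ (prefix (length p) (σ^ (length s) x)) [] m)
        where
        word≡ : prefix (length s) x ++ prefix (length p) (σ^ (length s) x) ≡ word x
        word≡ = trans (sym (prefix-+ (length s) (length p) x))
          (cong (λ k → prefix k x) (trans (ℕₚ.+-comm (length s) (length p)) (sym d≡)))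
      ...   | inj₂ (_ , lt) = contradiction (minimum-≤ min (length s))
        (ℕₚ.<⇒≱ (subst (σ^ (length s) x Fin.<_)
          (trans (sym (iterate-+ σ x (length p) (length s))) (trans (cong (λ k → σ^ k x) (sym d≡)) (σ^period x))) lt))

    -- The positions u, σ^e u, σ^2e u, ... would increase forever below y.
    no-increasing-orbit : ∀ e {y} → σ^ e y ≡ y → ∀ u → Acc Fin._>_ u →
      u Fin.< σ^ e u → σ^ e u Fin.< y → prefix e u ≡ prefix e y → ⊥
    no-increasing-orbit e {y} fix u (acc rec) u<u′ u′<y eq with prefix-mono e u<u′ | prefix-mono e u′<y
    ... | inj₁ m            | inj₁ k           = ≪-asym m (subst (prefix e (σ^ e u) ≪_) (sym eq) k)
    ... | inj₁ m            | inj₂ (eq′ , _)   = ≪-irrefl (subst (_≪ prefix e (σ^ e u)) (trans eq (sym eq′)) m)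
    ... | inj₂ (eq′ , _)    | inj₁ k           = ≪-irrefl (subst (_≪ prefix e y) (trans (sym eq′) eq) k)
    ... | inj₂ (_ , u′<u″)  | inj₂ (eq′ , lt)  =
      no-increasing-orbit e fix (σ^ e u) (rec u<u′) u′<u″ (subst (σ^ e (σ^ e u) Fin.<_) fix lt) eq′

    -- Compare along the shorter word. Without a mismatch, a shorter or equally long `word x` is a
    -- prefix of `word y`. If `word y` is shorter, with length `e`, then `x < σ^ e x < y`, and these
    -- positions would start an endless increasing orbit.
    word-mono : ∀ {x y} → Minimum x → Minimum y → x Fin.< y → word x ⪯ word y
    word-mono {x} {y} minx miny x<y with ℕₚ.≤-<-connex (period x) (period y)
    ... | inj₁ d≤e with ℕₚ.m≤n⇒∃[o]m+o≡n d≤e | prefix-mono (period x) x<y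
    ...   | k , d+k≡e | m = subst (word x ⪯_)
            (trans (sym (prefix-+ (period x) k y)) (cong (λ j → prefix j y) d+k≡e)) (compare m)
      where
      rest : Word
      rest = prefix k (σ^ (period x) y)
      compare : prefix (period x) x ≪ prefix (period x) y ⊎ (prefix (period x) x ≡ prefix (period x) y × _) →
        word x ⪯ (prefix (period x) y ++ rest)
      compare (inj₁ m)        = inj₁ (subst (_≺ (prefix (period x) y ++ rest)) (Listₚ.++-identityʳ (word x)) (≪-++ [] rest m))
      compare (inj₂ (eq , _)) = subst (λ w → word x ⪯ (w ++ rest)) eq (⪯-++ (word x) rest)
    word-mono {x} {y} minx miny x<y | inj₂ e<d with ℕₚ.m≤n⇒∃[o]m+o≡n (ℕₚ.<⇒≤ e<d) | prefix-mono (period y) x<y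
    ...   | k , e+k≡d | inj₁ m = inj₁ (subst₂ _≺_
            (trans (sym (prefix-+ (period y) k x)) (cong (λ j → prefix j x) e+k≡d)) (Listₚ.++-identityʳ (word y))
            (≪-++ (prefix k (σ^ (period y) x)) [] m))
    ...   | _ | inj₂ (eq , lt) = ⊥-elim (no-increasing-orbit (period y) (σ^period y) x (FinInd.>-wellFounded x)
            (minimum-< minx z<s e<d) (subst (σ^ (period y) x Fin.<_) (σ^period y) lt) eq)

    factors-lyndon : IsLyndonFactorization factors (concat factors)
    factors-lyndon = Allₚ.map⁺ (All.map word-lyndon minima-all) , refl ,
      Linkedₚ.map⁺ (Linkedₚ.AllPairs⇒Linked (go minima-all minima-descending))
      where
      go : ∀ {xs} → All Minimum xs → AllPairs Fin._>_ xs → AllPairs (λ x y → word y ⪯ word x) xs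
      go []           []          = []
      go (min ∷ mins) (x> ∷ desc) = All.zipWith (λ (miny , x>y) → word-mono miny min x>y) (mins , x>) ∷ go mins desc

    pow∞-word : ∀ x i → pow∞ (ℓ (σ x)) (prefix (period-1 x) (σ x)) i ≡ ℓ (σ (σ^ i x))
    pow∞-word x i = begin
      lookup (word x) (fromℕ< (m%n<n i (length (word x))))           ≡⟨ Listₚ.lookup-applyUpTo (λ i → ℓ (σ (σ^ i x))) (period x) (fromℕ< (m%n<n i (length (word x)))) ⟩
      ℓ (σ (σ^ (toℕ (fromℕ< (m%n<n i (length (word x))))) x))        ≡⟨ cong (λ k → ℓ (σ (σ^ k x))) (Finₚ.toℕ-fromℕ< (m%n<n i (length (word x)))) ⟩
      ℓ (σ (σ^ (i % suc (length (prefix (period-1 x) (σ x)))) x))    ≡⟨ cong (λ k → ℓ (σ (σ^ (i % suc k) x))) (Listₚ.length-applyUpTo _ (period-1 x)) ⟩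
      ℓ (σ (σ^ (i % period x) x))                                    ≡⟨ cong (ℓ ∘ σ) (σ^-% i x) ⟨
      ℓ (σ (σ^ i x))                                                 ∎
      where open ≡-Reasoning

    -- As long as the letters agree, stability preserves the order of the positions, so the first
    -- mismatch follows that order.
    no-inversion : ∀ k {x y} → x Fin.< y → (∀ i → i < k → ℓ (σ (σ^ i y)) ≡ ℓ (σ (σ^ i x))) →
      ¬ ℓ (σ (σ^ k y)) ⊏ ℓ (σ (σ^ k x))
    no-inversion k x<y agree gt with stable x<y
    no-inversion zero    x<y agree gt | inj₁ lt            = ⊏.asym lt gt
    no-inversion zero    x<y agree gt | inj₂ (eq , _)      = ⊏.irrefl (sym eq) gt
    no-inversion (suc k) x<y agree gt | inj₁ lt            = ⊏.irrefl (sym (agree 0 z<s)) lt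
    no-inversion (suc k) x<y agree gt | inj₂ (_ , σx<σy)   = no-inversion k σx<σy (λ i i<k → agree (suc i) (s<s i<k)) gt

    word-ω-mono : ∀ {x y} → x Fin.< y → ¬ word y ≺ω word x
    word-ω-mono {x} {y} x<y (k , agree , gt) = no-inversion k x<y
      (λ i i<k → trans (sym (pow∞-word y i)) (trans (agree i i<k) (pow∞-word x i)))
      (subst₂ _⊏_ (pow∞-word y k) (pow∞-word x k) gt)

    word-last : ∀ x → ∃ λ p → word x ≡ p ∷ʳ ℓ x
    word-last x = prefix (period-1 x) x , trans (sym (Listₚ.applyUpTo-∷ʳ _ (period-1 x)))
      (cong (λ y → prefix (period-1 x) x ∷ʳ ℓ y) (trans (sym (σ^-suc (period-1 x) x)) (σ^period x)))

    -- Since `σ (π x)` is `x`, the last letter `ℓ x` of `word x` is the first letter read from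
    -- `π x`, and the reading then goes on from `x`.
    rot-word : ∀ x → rot (word x) ≡ word (π x)
    rot-word x = begin
      rot (word x)                                           ≡⟨ cong rot (Listₚ.applyUpTo-∷ʳ _ (period-1 x)) ⟨
      rot (prefix (period-1 x) x ∷ʳ ℓ (σ (σ^ (period-1 x) x))) ≡⟨ rot-∷ʳ (prefix (period-1 x) x) _ ⟩
      ℓ (σ (σ^ (period-1 x) x)) ∷ prefix (period-1 x) x      ≡⟨ cong (λ y → ℓ y ∷ prefix (period-1 x) x) (trans (sym (σ^-suc (period-1 x) x)) (σ^period x)) ⟩
      ℓ x ∷ prefix (period-1 x) x                            ≡⟨ cong (λ y → ℓ y ∷ prefix (period-1 x) y) (σπ x) ⟨
      prefix (suc (period-1 x)) (π x)                        ≡⟨ cong (λ k → prefix (suc k) (π x)) (period-π x) ⟨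
      word (π x)                                             ∎
      where open ≡-Reasoning

    rotationsN-word : ∀ k x → rotationsN k (word x) ≡ map word (applyUpTo (iterate π x) k)
    rotationsN-word zero    x = refl
    rotationsN-word (suc k) x = cong (word x ∷_) (trans (cong (rotationsN k) (rot-word x)) (rotationsN-word k (π x)))

    length-word : ∀ x → length (word x) ≡ period x
    length-word x = Listₚ.length-applyUpTo (λ i → ℓ (σ (σ^ i x))) (period x)

    rotations-word : ∀ x → rotations (word x) ↭ map word (cycle x)
    rotations-word x = ↭-trans (↭-reflexive (trans (cong (λ k → rotationsN k (word x)) (length-word x))
      (rotationsN-word (period x) x))) (↭ₚ.map⁺ word (π-cycle-↭ x))

    -- The rotations of the word of a cycle are the words started at its positions, and the cycles
    -- partition all positions.
    rotations-factors : map word (allFin n) ↭ concatMap rotations factors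
    rotations-factors = ↭-sym (↭-trans (↭-reflexive (Listₚ.concatMap-map rotations word minima))
      (↭-trans (concatMap-↭ rotations-word minima)
      (↭-trans (↭-reflexive (sym (Listₚ.map-concatMap word cycle minima))) (↭ₚ.map⁺ word cycles-partition))))

    words-ωSorted : ωSorted (map word (allFin n))
    words-ωSorted = AllPairsₚ.map⁺ (AllPairsₚ.tabulate⁺-< word-ω-mono)

    allFin-σ : map σ (allFin n) ↭ allFin n
    allFin-σ = unique-set⇒↭ (Uniqueₚ.map⁺ σ-injective (Uniqueₚ.allFin⁺ n)) (Uniqueₚ.allFin⁺ n)
      (λ _ → ∈ₚ.∈-allFin _) (λ {x} _ → subst (_∈ map σ (allFin n)) (σπ x) (∈ₚ.∈-map⁺ σ (∈ₚ.∈-allFin (π x))))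

    concat-factors : concat factors ↭ map ℓ (allFin n)
    concat-factors = ↭-trans (↭-reflexive (begin
      concatMap word minima                     ≡⟨ Listₚ.concatMap-cong (λ x → Listₚ.map-applyUpTo (iterate σ x) (ℓ ∘ σ) (period x)) minima ⟨
      concatMap (map (ℓ ∘ σ) ∘ cycle) minima    ≡⟨ Listₚ.map-concatMap (ℓ ∘ σ) cycle minima ⟨
      map (ℓ ∘ σ) (concatMap cycle minima)      ∎))
      (↭-trans (↭ₚ.map⁺ (ℓ ∘ σ) cycles-partition)
      (↭-trans (↭-reflexive (Listₚ.map-∘ (allFin n))) (↭ₚ.map⁺ ℓ allFin-σ)))
      where open ≡-Reasoning

  -- The cycle through the first position.

  _⊑_ : A → A → Set
  a ⊑ b = a ⊏ b ⊎ a ≡ b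

  ⊑⇒¬⊐ : ∀ {a b} → a ⊑ b → ¬ b ⊏ a
  ⊑⇒¬⊐ (inj₁ a<b)  b<a = ⊏.asym a<b b<a
  ⊑⇒¬⊐ (inj₂ refl) b<a = ⊏.irrefl refl b<a

  -- By early, the stable order of positions begins 1, …, p.
  module FirstCycle {m : ℕ} (ℓ : Fin (suc m) → A) (p : ℕ) (p≤m : p ≤ m)
    (early : ∀ i j → 0 < toℕ i → toℕ i ≤ p → toℕ j ≡ 0 ⊎ toℕ i < toℕ j →
      ℓ i ⊏ ℓ j ⊎ (ℓ i ≡ ℓ j × i Fin.< j)) where

    open Inverse ℓ

    private
      ¬early : ∀ {i j} → ℓ i ⊏ ℓ j ⊎ (ℓ i ≡ ℓ j × i Fin.< j) → ¬ (ℓ j ⊏ ℓ i ⊎ (ℓ j ≡ ℓ i × j Fin.< i))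
      ¬early (inj₁ lt)         (inj₁ gt)         = ⊏.asym lt gt
      ¬early (inj₁ lt)         (inj₂ (eq , _))   = ⊏.irrefl (sym eq) lt
      ¬early (inj₂ (eq , _))   (inj₁ gt)         = ⊏.irrefl (sym eq) gt
      ¬early (inj₂ (_ , i<j))  (inj₂ (_ , j<i))  = ℕₚ.<-asym i<j j<i

      -- Let `r` be the rank of position `P`, that is, `i + 1`. If `r < q`, the induction hypothesis
      -- gives `σ r` as `r + 1`, too small to be `P`. If `q < r`, then `σ q` precedes `P` in the
      -- stable order; by `early` it is one of the positions 1 to `i`, but these already have
      -- smaller ranks.
      step : ∀ i → i < p → (∀ k → k ≤ i → toℕ (σ^ k zero) ≡ k) → toℕ (σ^ (suc i) zero) ≡ suc i
      step i i<p below = trans (cong toℕ (trans (σ^-suc i zero) σq≡P)) P≡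
        where
        q P r : Fin (suc m)
        q = σ^ i zero
        P = fromℕ< (s≤s (ℕₚ.≤-trans i<p p≤m))
        r = π P
        P≡ : toℕ P ≡ suc i
        P≡ = Finₚ.toℕ-fromℕ< (s≤s (ℕₚ.≤-trans i<p p≤m))
        toℕq : toℕ q ≡ i
        toℕq = below i ℕₚ.≤-refl
        P-early : ∀ j → toℕ j ≡ 0 ⊎ suc i < toℕ j → ℓ P ⊏ ℓ j ⊎ (ℓ P ≡ ℓ j × P Fin.< j)
        P-early j cond = early P j (subst (0 <_) (sym P≡) z<s) (subst (_≤ p) (sym P≡) i<p)
          (Sum.map₂ (subst (_< toℕ j) (sym P≡)) cond)
        σ-below : ∀ {k x} → k < i → toℕ x ≡ k → toℕ (σ x) ≡ suc k
        σ-below {k} k<i x≡k = trans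
          (cong toℕ (trans (cong σ (Finₚ.toℕ-injective (trans x≡k (sym (below k (ℕₚ.<⇒≤ k<i)))))) (sym (σ^-suc k zero))))
          (below (suc k) k<i)
        σq≡P : σ q ≡ P
        σq≡P with Finₚ.<-cmp q r
        ... | tri≈ _ q≡r _ = trans (cong σ q≡r) (σπ P)
        ... | tri> _ _ r<q = contradiction
          (trans (sym P≡) (trans (cong toℕ (sym (σπ P))) (σ-below r<i refl))) (ℕₚ.<⇒≢ (s<s r<i) ∘ sym)
          where
          r<i : toℕ r < i
          r<i = subst (toℕ r <_) toℕq r<q
        ... | tri< q<r _ _ with ℕₚ.<-cmp (toℕ (σ q)) (suc i)
        ...   | tri≈ _ eq _ = Finₚ.toℕ-injective (trans eq (sym P≡))
        ...   | tri> _ _ gt = contradiction (subst (λ y → ℓ (σ q) ⊏ ℓ y ⊎ (ℓ (σ q) ≡ ℓ y × σ q Fin.< y)) (σπ P) (stable q<r))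
          (¬early (P-early (σ q) (inj₂ gt)))
        ...   | tri< lt _ _ with toℕ (σ q) in eq
        ...     | zero = contradiction (subst (λ y → ℓ (σ q) ⊏ ℓ y ⊎ (ℓ (σ q) ≡ ℓ y × σ q Fin.< y)) (σπ P) (stable q<r))
          (¬early (P-early (σ q) (inj₁ eq)))
        ...     | suc k = contradiction k≡i (ℕₚ.<⇒≢ (ℕₚ.≤-pred lt))
          where
          k<i : k < i
          k<i = ℕₚ.≤-pred lt
          k≡i : k ≡ i
          k≡i = trans (sym (below k (ℕₚ.<⇒≤ k<i))) (trans (cong toℕ (σ-injective
            (Finₚ.toℕ-injective (trans (cong toℕ (sym (σ^-suc k zero))) (trans (below (suc k) k<i) (sym eq)))))) toℕq)

      upTo : ∀ i → i ≤ p → ∀ k → k ≤ i → toℕ (σ^ k zero) ≡ k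
      upTo zero    _   zero _ = refl
      upTo (suc i) i<p k k≤1+i with ℕₚ.m≤n⇒m<n∨m≡n k≤1+i
      ... | inj₁ k≤i  = upTo i (ℕₚ.<⇒≤ i<p) k (ℕₚ.≤-pred k≤i)
      ... | inj₂ refl = step i i<p (upTo i (ℕₚ.<⇒≤ i<p))

    σ^-zero : ∀ i → i ≤ p → toℕ (σ^ i zero) ≡ i
    σ^-zero i i≤p = upTo i i≤p i ℕₚ.≤-refl

    p≤period-1 : p ≤ period-1 zero
    p≤period-1 = ℕₚ.≮⇒≥ λ d<p → contradiction
      (trans (sym (σ^-zero (period zero) d<p)) (cong toℕ (σ^period zero))) λ ()

    nextLetter : A
    nextLetter = ℓ (σ (σ^ p zero))

    -- The ranks below `p` are taken by the positions 1 to `p`, so every other position has rank at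
    -- least `p`, the rank of `nextLetter`.
    nextLetter-least : ∀ j → toℕ j ≡ 0 ⊎ p < toℕ j → nextLetter ⊑ ℓ j
    nextLetter-least j late with Finₚ.<-cmp (σ^ p zero) (π j)
    ... | tri< lt _ _ = subst (λ y → nextLetter ⊑ ℓ y) (σπ j) (Sum.map₂ proj₁ (stable lt))
    ... | tri≈ _ eq _ = inj₂ (cong ℓ (trans (cong σ eq) (σπ j)))
    ... | tri> _ _ gt = contradiction late notLate
      where
      k<p : toℕ (π j) < p
      k<p = subst (toℕ (π j) <_) (σ^-zero p ℕₚ.≤-refl) gt
      j≡ : toℕ j ≡ suc (toℕ (π j))
      j≡ = trans (cong toℕ (trans (sym (σπ j)) (trans
        (cong σ (Finₚ.toℕ-injective (sym (σ^-zero (toℕ (π j)) (ℕₚ.<⇒≤ k<p))))) (sym (σ^-suc (toℕ (π j)) zero)))))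
        (σ^-zero (suc (toℕ (π j))) k<p)
      notLate : ¬ (toℕ j ≡ 0 ⊎ p < toℕ j)
      notLate (inj₁ j≡0) = contradiction (trans (sym j≡) j≡0) λ ()
      notLate (inj₂ p<j) = ℕₚ.<⇒≱ p<j (subst (_≤ p) (sym j≡) k<p)

    zero-minimum : Minimum zero
    zero-minimum = All.universal (λ _ → z≤n) (cycle zero)

    minima-last : ∃ λ xs → minima ≡ xs ∷ʳ zero
    minima-last = filter minimum? (map suc (downFin m)) ,
      trans (Listₚ.filter-++ minimum? (map suc (downFin m)) [ zero ])
        (cong (filter minimum? (map suc (downFin m)) ++_) (Listₚ.filter-accept minimum? zero-minimum))

    -- Position `zero` is the last of the minima, so its word is the last factor, and that word has
    -- more than `p` letters.
    factors-contain : ∃₂ λ pre post → concat factors ≡ pre ++ prefix p zero ++ nextLetter ∷ post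
    factors-contain with minima-last | ℕₚ.m≤n⇒∃[o]m+o≡n p≤period-1
    ... | xs , minima≡ | k , p+k≡ = concatMap word xs , prefix k (σ (σ^ p zero)) , (begin
      concatMap word minima                           ≡⟨ cong (concatMap word) minima≡ ⟩
      concatMap word (xs ∷ʳ zero)                     ≡⟨ Listₚ.concatMap-++ word xs [ zero ] ⟩
      concatMap word xs ++ word zero ++ []            ≡⟨ cong (concatMap word xs ++_) (Listₚ.++-identityʳ (word zero)) ⟩
      concatMap word xs ++ word zero                  ≡⟨ cong (λ d → concatMap word xs ++ prefix d zero) (trans (cong suc (sym p+k≡)) (sym (ℕₚ.+-suc p k))) ⟩
      concatMap word xs ++ prefix (p + suc k) zero    ≡⟨ cong (concatMap word xs ++_) (prefix-+ p (suc k) zero) ⟩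
      concatMap word xs ++ prefix p zero ++ nextLetter ∷ prefix k (σ (σ^ p zero)) ∎)
      where open ≡-Reasoning

  lookup-++ : ∀ (s t : Word) (i : Fin (length s)) (j : Fin (length (s ++ t))) → toℕ j ≡ toℕ i → lookup (s ++ t) j ≡ lookup s i
  lookup-++ (c ∷ s) t zero    zero    _  = refl
  lookup-++ (c ∷ s) t (suc i) (suc j) eq = lookup-++ s t i j (ℕₚ.suc-injective eq)

  lookup-late : ∀ {P : A → Set} (s t : Word) →
    (∀ j → length s ≤ toℕ j → P (lookup (s ++ t) j)) → All P t
  lookup-late {P} []  t late = All.tabulate λ x∈t → subst P (sym (Anyₚ.lookup-index x∈t)) (late (index x∈t) z≤n)
  lookup-late (c ∷ s) t late = lookup-late s t (λ j s≤j → late (suc j) (s≤s s≤j))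

  lookup-early : ∀ {P : A → Set} {s : Word} (t : Word) → All P s → ∀ i → toℕ i < length s → P (lookup (s ++ t) i)
  lookup-early t (px ∷ pxs) zero    _          = px
  lookup-early t (px ∷ pxs) (suc i) (s<s i<s)  = lookup-early t pxs i i<s

  lookup-sorted : ∀ {s t : Word} → AllPairs _⊑_ s → All (λ c → All (c ⊑_) t) s →
    ∀ i j → toℕ i < length s → toℕ i < toℕ j → lookup (s ++ t) i ⊑ lookup (s ++ t) j
  lookup-sorted (c⊑s ∷ _)  (c⊑t ∷ _)   zero    (suc j) _         _         = All.lookup (Allₚ.++⁺ c⊑s c⊑t) (∈ₚ.∈-lookup j)
  lookup-sorted (_ ∷ s↗)   (_ ∷ s⊑t)   (suc i) (suc j) (s<s i<s) (s<s i<j) = lookup-sorted s↗ s⊑t i j i<s i<j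

  -- The letters of `s` occupy the positions 1 to `length s`. Against later positions they win ties
  -- by stability; against `x`, which stands before them, they would lose a tie, hence the strict
  -- bound.
  inverse-contains : ∀ x s t → AllPairs _⊑_ s → All (_⊏ x) s → All (λ c → All (c ⊑_) t) s →
    ∃₂ λ pre post → ∃ λ c → concat (Inverse.factors (lookup (x ∷ s ++ t))) ≡ pre ++ s ++ c ∷ post × All (c ⊑_) (x ∷ t)
  inverse-contains x s t s↗ s⊏x s⊑t = pre , post , nextLetter ,
    trans eq (cong (λ w → pre ++ w ++ nextLetter ∷ post) prefix≡s) ,
    nextLetter-least zero (inj₁ refl) ∷ lookup-late s t (λ j s≤j → nextLetter-least (suc j) (inj₂ (s≤s s≤j)))
    where
    ℓ : Fin (suc (length (s ++ t))) → A
    ℓ = lookup (x ∷ s ++ t)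
    early : ∀ i j → 0 < toℕ i → toℕ i ≤ length s → toℕ j ≡ 0 ⊎ toℕ i < toℕ j →
      ℓ i ⊏ ℓ j ⊎ (ℓ i ≡ ℓ j × i Fin.< j)
    early (suc i) zero    _ i<s _                = inj₁ (lookup-early t s⊏x i i<s)
    early (suc i) (suc j) _ i<s (inj₂ (s<s i<j)) = Sum.map₂ (_, s<s i<j) (lookup-sorted s↗ s⊑t i j i<s i<j)
    open FirstCycle ℓ (length s) (subst (length s ≤_) (sym (Listₚ.length-++ s)) (ℕₚ.m≤m+n (length s) (length t))) early
    open Inverse ℓ using (prefix; σ; σ^; σ^-suc)
    pre post : Word
    pre = proj₁ factors-contain
    post = proj₁ (proj₂ factors-contain)
    eq : concat (Inverse.factors (lookup (x ∷ s ++ t))) ≡ pre ++ prefix (length s) zero ++ nextLetter ∷ post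
    eq = proj₂ (proj₂ factors-contain)
    prefix≡s : prefix (length s) zero ≡ s
    prefix≡s = applyUpTo-lookup (λ i → ℓ (σ (σ^ i zero))) s λ i →
      lookup-++ (x ∷ s) t (suc i) (σ (σ^ (toℕ i) zero))
        (trans (cong toℕ (sym (σ^-suc (toℕ i) zero))) (σ^-zero (suc (toℕ i)) (Finₚ.toℕ<n i)))

  abstract
    invert : Word → Word
    invert z = concat (Inverse.factors (lookup z))

    invert-↭ : ∀ z → invert z ↭ z
    invert-↭ z = ↭-trans (Inverse.concat-factors (lookup z)) (↭-reflexive (map-lookup-allFin z))

    invert-BBWT : ∀ z → IsBBWT (invert z) z
    invert-BBWT z = factors , factors-lyndon , map word (allFin (length z)) , rotations-factors , words-ωSorted ,
      subst (λ w → Pointwise (λ c r → ∃ λ p → r ≡ p ∷ʳ c) w (map word (allFin (length z)))) (map-lookup-allFin z)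
        (Pointwise.map⁺ (lookup z) word (Pointwise.refl (λ {x} → word-last x)))
      where open Inverse (lookup z)

    invert-contains : ∀ x s t → AllPairs _⊑_ s → All (_⊏ x) s → All (λ c → All (c ⊑_) t) s →
      ∃₂ λ pre post → ∃ λ c → invert (x ∷ s ++ t) ≡ pre ++ s ++ c ∷ post × All (c ⊑_) (x ∷ t)
    invert-contains = inverse-contains

-- Uniqueness of the Lyndon factorization and of the BBWT.

-- Levi's lemma.
++-align : {X : Set} (xs : List X) {ys : List X} (zs : List X) {ws : List X} → xs ++ ys ≡ zs ++ ws →
  (∃ λ t → zs ≡ xs ++ t × ys ≡ t ++ ws) ⊎ (∃ λ t → xs ≡ zs ++ t × ws ≡ t ++ ys)
++-align []       zs       eq = inj₁ (zs , refl , eq)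
++-align (x ∷ xs) []       eq = inj₂ (x ∷ xs , refl , sym eq)
++-align (x ∷ xs) (z ∷ zs) eq with Listₚ.∷-injectiveˡ eq
... | refl = Sum.map (λ (t , p , q) → t , cong (x ∷_) p , q) (λ (t , p , q) → t , cong (x ∷_) p , q)
  (++-align xs zs (Listₚ.∷-injectiveʳ eq))

-- `v` is the part of `x` inside the block that contains the last letter of `x`.
suffix-in-block : {X : Set} (us : List (List X)) (x : List X) {rest : List X} → concat us ≡ x ++ rest → x ≢ [] →
  ∃₂ λ p v → x ≡ p ++ v × v ≢ [] × Any (λ u → ∃ λ t → u ≡ v ++ t) us
suffix-in-block []       []      eq x≢[] = contradiction refl x≢[]
suffix-in-block (u ∷ us) x       eq x≢[] with ++-align u x eq
... | inj₂ (t , u≡x++t , _) = [] , x , refl , x≢[] , here (t , u≡x++t)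
... | inj₁ ([] , x≡ , _)    = [] , x , refl , x≢[] , here ([] , trans (sym (Listₚ.++-identityʳ u)) (trans (sym x≡) (sym (Listₚ.++-identityʳ x))))
... | inj₁ (c ∷ t , x≡ , eq′) with suffix-in-block us (c ∷ t) eq′ (λ ())
...   | p , v , t≡ , v≢[] , v∈ = u ++ p , v ,
  trans x≡ (trans (cong (u ++_) t≡) (sym (Listₚ.++-assoc u p v))) , v≢[] , there v∈

lookup-∷ʳ : {X : Set} (p : List X) (c : X) (i : Fin (length (p ∷ʳ c))) → toℕ i ≡ length p → lookup (p ∷ʳ c) i ≡ c
lookup-∷ʳ []      c zero    _  = refl
lookup-∷ʳ (x ∷ p) c (suc i) eq = lookup-∷ʳ p c i (ℕₚ.suc-injective eq)

last-∷ʳ : {X : Set} (p : List X) (c : X) → last (p ∷ʳ c) ≡ just c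
last-∷ʳ []          c = refl
last-∷ʳ (x ∷ [])    c = refl
last-∷ʳ (x ∷ y ∷ p) c = last-∷ʳ (y ∷ p) c

module Determinism (A : Set) (_⊏_ : Rel A 0ℓ) (sto : IsStrictTotalOrder _≡_ _⊏_) where

  open Words A _⊏_ sto
  open BBWT A _⊏_ sto using (strictTotalOrder; ⪯-++)
  private module ⊏ = IsStrictTotalOrder sto

  ≺-irrefl : ∀ {u} → ¬ u ≺ u
  ≺-irrefl (head≺ lt) = ⊏.irrefl refl lt
  ≺-irrefl (tail≺ lt) = ≺-irrefl lt

  ≺-trans : ∀ {u v w} → u ≺ v → v ≺ w → u ≺ w
  ≺-trans []≺∷      (head≺ _) = []≺∷
  ≺-trans []≺∷      (tail≺ _) = []≺∷
  ≺-trans (head≺ p) (head≺ q) = head≺ (⊏.trans p q)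
  ≺-trans (head≺ p) (tail≺ _) = head≺ p
  ≺-trans (tail≺ _) (head≺ q) = head≺ q
  ≺-trans (tail≺ p) (tail≺ q) = tail≺ (≺-trans p q)

  ⪯-trans : ∀ {u v w} → u ⪯ v → v ⪯ w → u ⪯ w
  ⪯-trans (inj₁ p)    (inj₁ q)    = inj₁ (≺-trans p q)
  ⪯-trans (inj₁ p)    (inj₂ refl) = inj₁ p
  ⪯-trans (inj₂ refl) q           = q

  ≺-⪯-trans : ∀ {u v w} → u ≺ v → v ⪯ w → u ≺ w
  ≺-⪯-trans p (inj₁ q)    = ≺-trans p q
  ≺-⪯-trans p (inj₂ refl) = p

  -- A longer first factor would have a proper suffix that is a prefix of a later factor of the other
  -- factorization, hence at most the shorter first factor, which is a prefix of the longer one.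
  first-factor-maximal : ∀ {u c t rest} us → Lyndon u → Lyndon (u ++ c ∷ t) → All (_⪯ u) us → concat us ≢ (c ∷ t) ++ rest
  first-factor-maximal {u} {c} {t} us (u≢[] , _) (_ , least) us⪯u eq
    with suffix-in-block us (c ∷ t) eq (λ ())
  ... | p , v , ct≡ , v≢[] , v-prefix = ≺-irrefl (≺-⪯-trans x≺v (⪯-trans (v⪯u us⪯u v-prefix) (⪯-++ u (c ∷ t))))
    where
    x≺v : (u ++ c ∷ t) ≺ v
    x≺v = least (u ++ p) v (trans (cong (u ++_) ct≡) (sym (Listₚ.++-assoc u p v)))
      (u≢[] ∘ Listₚ.++-conicalˡ u p) v≢[]
    v⪯u : ∀ {us} → All (_⪯ u) us → Any (λ u′ → ∃ λ t′ → u′ ≡ v ++ t′) us → v ⪯ u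
    v⪯u (u′⪯u ∷ _) (here (t′ , refl)) = ⪯-trans (⪯-++ v t′) u′⪯u
    v⪯u (_ ∷ us⪯u) (there v∈)         = v⪯u us⪯u v∈

  -- By Levi's lemma the first factors are equal or one properly extends the other, which
  -- `first-factor-maximal` excludes.
  lyndon-unique : ∀ us vs → All Lyndon us → All Lyndon vs → AllPairs (λ a b → b ⪯ a) us → AllPairs (λ a b → b ⪯ a) vs →
    concat us ≡ concat vs → us ≡ vs
  lyndon-unique []       []       _ _ _ _ _ = refl
  lyndon-unique []       (v ∷ vs) _ ((v≢[] , _) ∷ _) _ _ eq = contradiction (Listₚ.++-conicalˡ v (concat vs) (sym eq)) v≢[]
  lyndon-unique (u ∷ us) []       ((u≢[] , _) ∷ _) _ _ _ eq = contradiction (Listₚ.++-conicalˡ u (concat us) eq) u≢[]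
  lyndon-unique (u ∷ us) (v ∷ vs) (lu ∷ lus) (lv ∷ lvs) (u⪰ ∷ us↘) (v⪰ ∷ vs↘) eq with ++-align u v eq
  ... | inj₁ ([] , v≡ , eq′)   = cong₂ _∷_ (trans (sym (Listₚ.++-identityʳ u)) (sym v≡)) (lyndon-unique us vs lus lvs us↘ vs↘ eq′)
  ... | inj₂ ([] , u≡ , eq′)   = cong₂ _∷_ (trans u≡ (Listₚ.++-identityʳ v)) (lyndon-unique us vs lus lvs us↘ vs↘ (sym eq′))
  ... | inj₁ (c ∷ t , refl , eq′) = contradiction eq′ (first-factor-maximal us lu lv u⪰)
  ... | inj₂ (c ∷ t , refl , eq′) = contradiction eq′ (first-factor-maximal vs lv lu v⪰)

  factorization-unique : ∀ {us vs w} → IsLyndonFactorization us w → IsLyndonFactorization vs w → us ≡ vs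
  factorization-unique {us} {vs} (lus , us≡ , us↘) (lvs , vs≡ , vs↘) = lyndon-unique us vs lus lvs
    (Linkedₚ.Linked⇒AllPairs (λ p q → ⪯-trans q p) us↘) (Linkedₚ.Linked⇒AllPairs (λ p q → ⪯-trans q p) vs↘) (trans us≡ (sym vs≡))

  -- Cutting the infinite powers at a common multiple N of all lengths turns the ω-order into the lexicographic
  -- order of words and keeps the last letters.
  unroll : ℕ → Word → Word
  unroll N []       = []
  unroll N (a ∷ as) = applyUpTo (pow∞ a as) N

  lexicographic : DecTotalOrder 0ℓ 0ℓ 0ℓ
  lexicographic = LexList.≤-decTotalOrder strictTotalOrder

  open DecTotalOrder lexicographic using () renaming (_≤_ to _≤ˡ_; totalOrder to lexicographicₜ; module Eq to Eqˡ)

  -- The second alternative has the shape of the ω-order, so words that are not in inverted ω-order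
  -- leave only the first.
  compareUpTo : ∀ N (f g : ℕ → A) → applyUpTo f N ≤ˡ applyUpTo g N ⊎ ∃ λ k → (∀ i → i < k → g i ≡ f i) × g k ⊏ f k
  compareUpTo zero    f g = inj₁ (base tt)
  compareUpTo (suc N) f g with ⊏.compare (f 0) (g 0)
  ... | tri< lt _ _ = inj₁ (this lt)
  ... | tri> _ _ gt = inj₂ (0 , (λ _ ()) , gt)
  ... | tri≈ _ eq _ = Sum.map (next eq)
    (λ (k , agree , lt) → suc k , (λ { zero _ → sym eq ; (suc i) (s<s i<k) → agree i i<k }) , lt)
    (compareUpTo N (f ∘ suc) (g ∘ suc))

  unroll-mono : ∀ N x y → ¬ y ≺ω x → x ≢ [] → y ≢ [] → unroll N x ≤ˡ unroll N y
  unroll-mono N []       y        _   x≢[] _    = contradiction refl x≢[]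
  unroll-mono N (a ∷ as) []       _   _    y≢[] = contradiction refl y≢[]
  unroll-mono N (a ∷ as) (b ∷ bs) y⊀x _    _    with compareUpTo N (pow∞ a as) (pow∞ b bs)
  ... | inj₁ le  = le
  ... | inj₂ y≺x = contradiction y≺x y⊀x

  EndsWith : A → Word → Set
  EndsWith c r = ∃ λ p → r ≡ p ∷ʳ c

  pow∞-last : ∀ a as c N → EndsWith c (a ∷ as) → length (a ∷ as) ∣ suc N → pow∞ a as N ≡ c
  pow∞-last a as c N (p , eq) (divides (suc q) N≡) = trans
    (lookup-≡ eq (fromℕ< (m%n<n N (length (a ∷ as)))))
    (lookup-∷ʳ p c _ (trans (Finₚ.toℕ-cast _ _) (trans (Finₚ.toℕ-fromℕ< _) (trans N% len≡))))
    where
    lookup-≡ : ∀ {xs ys : Word} (e : xs ≡ ys) i → lookup xs i ≡ lookup ys (Fin.cast (cong length e) i)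
    lookup-≡ {xs} refl i = cong (lookup xs) (sym (Finₚ.cast-is-id refl i))
    len≡ : length as ≡ length p
    len≡ = ℕₚ.suc-injective (trans (cong length eq) (trans (Listₚ.length-++ p) (ℕₚ.+-comm (length p) 1)))
    -- From `N + 1 = (q + 1) * (length as + 1)` it follows that
    -- `N = length as + q * (length as + 1)`.
    N% : N % length (a ∷ as) ≡ length as
    N% = trans (cong (_% length (a ∷ as)) (ℕₚ.suc-injective N≡))
      (trans ([m+kn]%n≡m%n (length as) q (length (a ∷ as))) (m<n⇒m%n≡m (ℕₚ.n<1+n (length as))))

  last-unroll : ∀ {c} r N → EndsWith c r → length r ∣ suc N → last (unroll (suc N) r) ≡ just c
  last-unroll []       N ([] , ()) _
  last-unroll []       N (_ ∷ _ , ()) _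
  last-unroll {c} (a ∷ as) N ends r∣N = trans (cong last (sym (Listₚ.applyUpTo-∷ʳ (pow∞ a as) N)))
    (trans (last-∷ʳ (applyUpTo (pow∞ a as) N) (pow∞ a as N)) (cong just (pow∞-last a as c N ends r∣N)))

  last-letters : ∀ {b L} N → Pointwise EndsWith b L → All (λ r → length r ∣ suc N) L →
    map last (map (unroll (suc N)) L) ≡ map just b
  last-letters N []             []         = refl
  last-letters N (ends ∷ endss) (d ∷ ds) = cong₂ _∷_ (last-unroll _ N ends d) (last-letters N endss ds)

  nonempty : ∀ {b L} → Pointwise EndsWith b L → All (_≢ []) L
  nonempty []                   = []
  nonempty ((p , refl) ∷ endss) = (λ eq → contradiction (Listₚ.++-conicalʳ p _ eq) λ ()) ∷ nonempty endss

  unroll-sorted : ∀ N {L} → ωSorted L → All (_≢ []) L → AllPairs _≤ˡ_ (map (unroll N) L)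
  unroll-sorted N []          []           = []
  unroll-sorted N (x≤ ∷ L↗) (x≢[] ∷ L≢[]) =
    Allₚ.map⁺ (All.zipWith (λ {y} (y⊀x , y≢[]) → unroll-mono N _ y y⊀x x≢[] y≢[]) (x≤ , L≢[])) ∷ unroll-sorted N L↗ L≢[]

  commonMultiple : ∀ L → All (_≢ []) L → ∃ λ N → All (λ r → length r ∣ suc N) L
  commonMultiple L L≢[] = ℕ.pred (product (map length L)) ,
    All.tabulate λ r∈L → subst (_ ∣_) (sym suc-pred) (∈⇒∣product (∈ₚ.∈-map⁺ length r∈L))
    where
    suc-pred : suc (ℕ.pred (product (map length L))) ≡ product (map length L)
    suc-pred = ℕₚ.suc-pred _ {{product≢0 (Allₚ.map⁺ (All.map length≢0 L≢[]))}}
      where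
      length≢0 : ∀ {r : Word} → r ≢ [] → NonZero (length r)
      length≢0 {[]}    r≢[] = contradiction refl r≢[]
      length≢0 {_ ∷ _} _    = _

  -- The two lists may order words with equal infinite powers differently, but such words unroll to
  -- the same word; the unrolled lists are therefore equal, and they still show the last letters.
  ωSorted-last : ∀ {b b′ L L′} → L ↭ L′ → ωSorted L → ωSorted L′ → Pointwise EndsWith b L → Pointwise EndsWith b′ L′ → b ≡ b′
  ωSorted-last {b} {b′} {L} {L′} L↭L′ L↗ L′↗ ends ends′ with commonMultiple L (nonempty ends)
  ... | N , ∣N = Listₚ.map-injective just-injective (begin
    map just b                                ≡⟨ last-letters N ends ∣N ⟨
    map last (map (unroll (suc N)) L)         ≡⟨ cong (map last) unrolled≡ ⟩
    map last (map (unroll (suc N)) L′)        ≡⟨ last-letters N ends′ (↭ₚ.All-resp-↭ L↭L′ ∣N) ⟩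
    map just b′                               ∎)
    where
    open ≡-Reasoning
    unrolled≡ : map (unroll (suc N)) L ≡ map (unroll (suc N)) L′
    unrolled≡ = Pointwise.Pointwise-≡⇒≡ (Pointwise.map Pointwise.Pointwise-≡⇒≡
      (Sortedₚ.↗↭↗⇒≋ lexicographicₜ
        (Sortedₚ.AllPairs⇒Sorted lexicographicₜ (unroll-sorted (suc N) L↗ (nonempty ends)))
        (Sortedₚ.AllPairs⇒Sorted lexicographicₜ (unroll-sorted (suc N) L′↗ (nonempty ends′)))
        (Homogeneous.map Eqˡ.reflexive (↭⇒↭ₛ (↭ₚ.map⁺ (unroll (suc N)) L↭L′)))))

  BBWT-deterministic : ∀ {w b b′} → IsBBWT w b → IsBBWT w b′ → b ≡ b′
  BBWT-deterministic (us , fact , L , L↭ , L↗ , ends) (us′ , fact′ , L′ , L′↭ , L′↗ , ends′)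
    with factorization-unique fact fact′
  ... | refl = ωSorted-last (↭-trans L↭ (↭-sym L′↭)) L↗ L′↗ ends ends′

-- Finite order of injective maps that rearrange letters.

encode : ∀ {m n} (is : List (Fin m)) → n ≡ length is → Fin (m ^ n)
encode is e = funToFin (λ i → lookup is (Fin.cast e i))

encode-injective : ∀ {m n} (is js : List (Fin m)) (e : n ≡ length is) (f : n ≡ length js) →
  encode is e ≡ encode js f → is ≡ js
encode-injective {m} {n} is js e f eq = lookup-ext is js e f λ i → begin
  lookup is (Fin.cast e i)                               ≡⟨ Finₚ.finToFun-funToFin (λ i → lookup is (Fin.cast e i)) i ⟨
  finToFun (encode is e) i                               ≡⟨ cong (λ k → finToFun {m} {n} k i) eq ⟩
  finToFun (encode js f) i                               ≡⟨ Finₚ.finToFun-funToFin (λ i → lookup js (Fin.cast f i)) i ⟩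
  lookup js (Fin.cast f i)                               ∎
  where
  open ≡-Reasoning
  lookup-ext : ∀ {Y : Set} {n} (xs ys : List Y) (e : n ≡ length xs) (f : n ≡ length ys) →
    (∀ i → lookup xs (Fin.cast e i) ≡ lookup ys (Fin.cast f i)) → xs ≡ ys
  lookup-ext []       []       e    f _  = refl
  lookup-ext []       (y ∷ ys) refl () _
  lookup-ext (x ∷ xs) []       refl () _
  lookup-ext (x ∷ xs) (y ∷ ys) refl f eq = cong₂ _∷_
    (eq zero) (lookup-ext xs ys refl (ℕₚ.suc-injective f) (eq ∘ suc))

module Codes {X : Set} (z : List X) where

  abstract
    positions : ∀ {w} → w ↭ z → ∃ λ is → w ≡ map (lookup z) is × length z ≡ length is
    positions w↭z with ↭ₚ.↭-map-inv (lookup z) {xs = allFin (length z)} (↭-trans (↭-reflexive (map-lookup-allFin z)) (↭-sym w↭z))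
    ... | is , w≡ , p = is , w≡ , trans (sym (Listₚ.length-tabulate id)) (↭ₚ.↭-length p)

    -- A rearrangement of `z` is `z` read along a list of `length z` positions. Repeated letters
    -- allow several such lists; it only matters that equal codes give equal words.
    code : ∀ {w} → w ↭ z → Fin (length z ^ length z)
    code w↭z = encode (proj₁ (positions w↭z)) (proj₂ (proj₂ (positions w↭z)))

    code-injective : ∀ {v w} (v↭z : v ↭ z) (w↭z : w ↭ z) → code v↭z ≡ code w↭z → v ≡ w
    code-injective v↭z w↭z eq =
      let (is , v≡ , e) = positions v↭z ; (js , w≡ , f) = positions w↭z in
      trans v≡ (trans (cong (map (lookup z)) (encode-injective is js e f eq)) (sym w≡))

permutation-periodic : {X : Set} {f : List X → List X} → (∀ {v w} → f v ≡ f w → v ≡ w) → (∀ w → f w ↭ w) →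
  ∀ z → ∃ λ d → iterate f z (suc d) ≡ z
permutation-periodic {f = f} inj f↭ z =
  orbit-periodic inj z (λ i → code (iterate↭ i)) (λ i j → code-injective (iterate↭ i) (iterate↭ j))
  where
  open Codes z
  iterate↭ : ∀ i → iterate f z i ↭ z
  iterate↭ zero    = ↭-refl
  iterate↭ (suc i) = ↭-trans (↭-reflexive (iterate-suc f z i)) (↭-trans (f↭ _) (iterate↭ i))

-- Symmetry of reachability and reduction to the sorted word.

module Reach (A : Set) (_⊏_ : Rel A 0ℓ) (sto : IsStrictTotalOrder _≡_ _⊏_) where

  open Words A _⊏_ sto
  open BBWT A _⊏_ sto
  open Determinism A _⊏_ sto using (BBWT-deterministic)
  private module ⊏ = IsStrictTotalOrder sto

  infix 4 _≈_
  _≈_ : Word → Word → Set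
  u ≈ v = Reachable u v × Reachable v u

  ≈-refl : ∀ {u} → u ≈ u
  ≈-refl = ε , ε

  ≈-sym : ∀ {u v} → u ≈ v → v ≈ u
  ≈-sym = swap

  ≈-trans : ∀ {u v w} → u ≈ v → v ≈ w → u ≈ w
  ≈-trans (p , q) (p′ , q′) = p ◅◅ p′ , q′ ◅◅ q

  ≈-reflexive : ∀ {u v} → u ≡ v → u ≈ v
  ≈-reflexive refl = ≈-refl

  iterate-forward : ∀ {f} → (∀ w → Step w (f w)) → ∀ k w → Reachable w (iterate f w k)
  iterate-forward step zero    w = ε
  iterate-forward step (suc k) w = step w ◅ iterate-forward step k _

  iterate-backward : ∀ {f} → (∀ w → Step (f w) w) → ∀ k w → Reachable (iterate f w k) w
  iterate-backward step zero    w = ε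
  iterate-backward step (suc k) w = iterate-backward step k _ ◅◅ (step w ◅ ε)

  rot-injective : ∀ {v w} → rot v ≡ rot w → v ≡ w
  rot-injective {v} {w} eq with initLast v | initLast w
  ... | []       | []       = refl
  ... | []       | w ∷ʳ′ d  = contradiction (trans eq (rot-∷ʳ w d)) λ ()
  ... | v ∷ʳ′ c  | []       = contradiction (trans (sym eq) (rot-∷ʳ v c)) λ ()
  ... | v ∷ʳ′ c  | w ∷ʳ′ d  with trans (sym (rot-∷ʳ v c)) (trans eq (rot-∷ʳ w d))
  ...   | refl = refl

  rot-↭ : ∀ w → rot w ↭ w
  rot-↭ w with initLast w
  ... | []       = ↭-refl
  ... | w ∷ʳ′ c  = ↭-trans (↭-reflexive (rot-∷ʳ w c)) (↭ₚ.∷↭∷ʳ c w)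

  -- If `suc d` rotations restore `w`, then `d` rotations lead from `rot w` back to `w`.
  rot-≈ : ∀ w → w ≈ rot w
  rot-≈ w with permutation-periodic rot-injective rot-↭ w
  ... | d , eq = (inj₁ refl ◅ ε) , subst (Reachable (rot w)) eq (iterate-forward (λ _ → inj₁ refl) d (rot w))

  invert-injective : ∀ {v w} → invert v ≡ invert w → v ≡ w
  invert-injective {v} {w} eq = BBWT-deterministic (subst (λ u → IsBBWT u v) eq (invert-BBWT v)) (invert-BBWT w)

  -- A BBWT step undoes one `invert`. As `w` is also `d` inversions beyond `invert w`, `d` BBWT
  -- steps lead from `w` to `invert w`.
  invert-≈ : ∀ w → w ≈ invert w
  invert-≈ w with permutation-periodic invert-injective invert-↭ w
  ... | d , eq = subst (λ u → Reachable u (invert w)) eq (iterate-backward (λ u → inj₂ (invert-BBWT u)) d (invert w)) ,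
    (inj₂ (invert-BBWT w) ◅ ε)

  ++-comm-≈ : ∀ s t → (s ++ t) ≈ (t ++ s)
  ++-comm-≈ []      t = ≈-reflexive (sym (Listₚ.++-identityʳ t))
  ++-comm-≈ (c ∷ s) t = ≈-trans (≈-sym (≈-trans (rot-≈ ((s ++ t) ∷ʳ c)) (≈-reflexive (rot-∷ʳ (s ++ t) c))))
    (≈-trans (≈-reflexive (Listₚ.++-assoc s t [ c ]))
    (≈-trans (++-comm-≈ s (t ∷ʳ c)) (≈-reflexive (Listₚ.++-assoc t [ c ] s))))

  Admissible : Word → Set
  Admissible w = Unique w ⊎ ∃₂ λ a b → All (λ c → c ≡ a ⊎ c ≡ b) w

  admissible-↭ : ∀ {v w} → v ↭ w → Admissible v → Admissible w
  admissible-↭ v↭w = Sum.map (↭ₛₚ.Unique-resp-↭ (setoid A) (↭⇒↭ₛ v↭w)) (λ (a , b , all) → a , b , ↭ₚ.All-resp-↭ v↭w all)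

  AllBelow : Word → Word → Set
  AllBelow s t = All (λ c → All (c ⊑_) t) s

  SortedForm : Word → Set
  SortedForm w = ∃ λ v → AllPairs _⊑_ v × v ↭ w × v ≈ w

  sortedForm-transport : ∀ {v w} → v ↭ w → v ≈ w → SortedForm v → SortedForm w
  sortedForm-transport v↭w v≈w (u , u↗ , u↭v , u≈v) = u , u↗ , ↭-trans u↭v v↭w , ≈-trans u≈v v≈w

  ++-cancelˡ-↭ : ∀ (s : Word) {t t′} → s ++ t ↭ s ++ t′ → t ↭ t′
  ++-cancelˡ-↭ []      p = p
  ++-cancelˡ-↭ (c ∷ s) p = ++-cancelˡ-↭ s (↭ₚ.drop-∷ p)

  constant-sorted : ∀ {x w} → All (_≡ x) w → AllPairs _⊑_ w
  constant-sorted []             = []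
  constant-sorted (refl ∷ const) = All.map (inj₂ ∘ sym) const ∷ constant-sorted const

  two-letters : ∀ {a b c x d} → c ≡ a ⊎ c ≡ b → x ≡ a ⊎ x ≡ b → d ≡ a ⊎ d ≡ b → c ⊏ x → d ≡ c ⊎ d ≡ x
  two-letters (inj₁ refl) _           (inj₁ refl) _   = inj₁ refl
  two-letters (inj₂ refl) _           (inj₂ refl) _   = inj₁ refl
  two-letters _           (inj₁ refl) (inj₁ refl) _   = inj₂ refl
  two-letters _           (inj₂ refl) (inj₂ refl) _   = inj₂ refl
  two-letters (inj₁ refl) (inj₁ refl) (inj₂ refl) c⊏c = contradiction c⊏c (⊏.irrefl refl)
  two-letters (inj₂ refl) (inj₂ refl) (inj₁ refl) c⊏c = contradiction c⊏c (⊏.irrefl refl)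

  unique-++-disjoint : ∀ {s t : Word} {x} → Unique (s ++ t) → x ∈ s → ¬ x ∈ t
  unique-++-disjoint {c ∷ s} (c∉ ∷ _)  (here refl) x∈t = All.lookup c∉ (∈ₚ.∈-++⁺ʳ s x∈t) refl
  unique-++-disjoint {c ∷ s} (_ ∷ uni) (there x∈s) x∈t = unique-++-disjoint uni x∈s x∈t

  -- Invariant: `s` is a prefix of the sorted word. Each round lengthens it by one letter or ends
  -- with a sorted word; the letter `x` cyclically before `s` decides how.
  sortedForm : ∀ k s t → length t ≡ k → Admissible (s ++ t) → AllPairs _⊑_ s → AllBelow s t → SortedForm (s ++ t)
  sortedForm zero    s []  _   _   s↗ _   = s ++ [] , subst (AllPairs _⊑_) (sym (Listₚ.++-identityʳ s)) s↗ , ↭-refl , ≈-refl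
  sortedForm (suc k) s t∷x len adm s↗ s⊑tx with initLast t∷x
  ... | t ∷ʳ′ x = cases
    where
    |t|≡k : length t ≡ k
    |t|≡k = ℕₚ.suc-injective (trans (trans (ℕₚ.+-comm 1 (length t)) (sym (Listₚ.length-++ t))) len)
    s⊑x : All (_⊑ x) s
    s⊑x = All.map (λ c⊑tx → All.head (Allₚ.++⁻ʳ t c⊑tx)) s⊑tx
    s⊑t : AllBelow s t
    s⊑t = All.map (Allₚ.++⁻ˡ t) s⊑tx
    rotated≡ : s ++ t ∷ʳ x ≡ (s ++ t) ∷ʳ x
    rotated≡ = sym (Listₚ.++-assoc s t [ x ])
    rotated≈ : x ∷ s ++ t ≈ s ++ t ∷ʳ x
    rotated≈ = ≈-trans (++-comm-≈ [ x ] (s ++ t)) (≈-reflexive (sym rotated≡))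
    rotated↭ : x ∷ s ++ t ↭ s ++ t ∷ʳ x
    rotated↭ = ↭-trans (↭ₚ.∷↭∷ʳ x (s ++ t)) (↭-reflexive (sym rotated≡))

    -- Rotating `x` to the front and inverting gives a word containing `s ++ [ c ]` with `c` least
    -- among the remaining letters; a further rotation moves this longer prefix to the front.
    viaBBWT : All (_⊏ x) s → SortedForm (s ++ t ∷ʳ x)
    viaBBWT s⊏x with invert-contains x s t s↗ s⊏x s⊑t
    ... | pre , post , c , inv≡ , c⊑xt = sortedForm-transport next↭ next≈
      (subst SortedForm (Listₚ.++-assoc s [ c ] (post ++ pre))
        (sortedForm k (s ∷ʳ c) (post ++ pre) |rest|≡k (admissible-↭ (↭-sym next↭′) adm)
          (AllPairsₚ.++⁺ s↗ ([] ∷ []) (All.map (λ c′⊑ → All.head c′⊑ ∷ []) s⊑crest))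
          (Allₚ.++⁺ (All.map All.tail s⊑crest) (All.tail c⊑crest ∷ []))))
      where
      next↭xst : s ++ c ∷ post ++ pre ↭ x ∷ s ++ t
      next↭xst = ↭-trans (↭-reflexive (sym (Listₚ.++-assoc s (c ∷ post) pre)))
        (↭-trans (↭ₚ.++-comm (s ++ c ∷ post) pre) (↭-trans (↭-reflexive (sym inv≡)) (invert-↭ (x ∷ s ++ t))))
      next↭ : s ++ c ∷ post ++ pre ↭ s ++ t ∷ʳ x
      next↭ = ↭-trans next↭xst rotated↭
      next↭′ : (s ∷ʳ c) ++ post ++ pre ↭ s ++ t ∷ʳ x
      next↭′ = ↭-trans (↭-reflexive (Listₚ.++-assoc s [ c ] (post ++ pre))) next↭
      next≈ : s ++ c ∷ post ++ pre ≈ s ++ t ∷ʳ x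
      next≈ = ≈-trans (≈-reflexive (sym (Listₚ.++-assoc s (c ∷ post) pre)))
        (≈-trans (++-comm-≈ (s ++ c ∷ post) pre)
        (≈-trans (≈-reflexive (sym inv≡)) (≈-trans (≈-sym (invert-≈ (x ∷ s ++ t))) rotated≈)))
      crest↭tx : c ∷ post ++ pre ↭ t ∷ʳ x
      crest↭tx = ++-cancelˡ-↭ s next↭
      s⊑crest : AllBelow s (c ∷ post ++ pre)
      s⊑crest = All.map (↭ₚ.All-resp-↭ (↭-sym crest↭tx)) s⊑tx
      c⊑crest : All (c ⊑_) (c ∷ post ++ pre)
      c⊑crest = ↭ₚ.All-resp-↭ (↭-sym (↭-trans crest↭tx (↭-sym (↭ₚ.∷↭∷ʳ x t)))) c⊑xt
      |rest|≡k : length (post ++ pre) ≡ k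
      |rest|≡k = trans (ℕₚ.suc-injective (trans (↭ₚ.↭-length crest↭tx) (sym (↭ₚ.↭-length (↭ₚ.∷↭∷ʳ x t))))) |t|≡k

    -- Distinct letters exclude this case. In the binary case, if no letter of `s` is below `x`,
    -- then `s` consists of copies of `x` and a rotation extends it to `x ∷ s`. Otherwise `s`
    -- contains both letters, so everything after it equals the larger one, `x`.
    repeated : Admissible (s ++ t ∷ʳ x) → x ∈ s → SortedForm (s ++ t ∷ʳ x)
    repeated (inj₁ unique) x∈s = contradiction (∈ₚ.∈-++⁺ʳ t (here refl)) (unique-++-disjoint unique x∈s)
    repeated (inj₂ (a , b , binary)) x∈s with any? (⊏._<? x) s
    ...   | no ¬s⊏x = sortedForm-transport rotated↭ rotated≈
      (sortedForm k (x ∷ s) t |t|≡k (admissible-↭ (↭-sym rotated↭) adm) (x⊑s ∷ s↗) (All.lookup s⊑t x∈s ∷ s⊑t))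
      where
      x⊑s : All (x ⊑_) s
      x⊑s = All.zipWith (λ (c⊏̸x , c⊑x) → Sum.[ (λ c⊏x → contradiction c⊏x c⊏̸x) , (λ c≡x → inj₂ (sym c≡x)) ] c⊑x)
        (Allₚ.¬Any⇒All¬ s ¬s⊏x , s⊑x)
    ...   | yes ∃c⊏x with find ∃c⊏x
    ...     | c , c∈s , c⊏x = s ++ t ∷ʳ x ,
      AllPairsₚ.++⁺ s↗ (constant-sorted (All.tabulate tx≡x)) s⊑tx , ↭-refl , ≈-refl
      where
      letter : ∀ {d} → d ∈ s ++ t ∷ʳ x → d ≡ a ⊎ d ≡ b
      letter = All.lookup binary
      tx≡x : ∀ {d} → d ∈ t ∷ʳ x → d ≡ x
      tx≡x {d} d∈ with two-letters (letter (∈ₚ.∈-++⁺ˡ c∈s)) (letter (∈ₚ.∈-++⁺ʳ s (∈ₚ.∈-++⁺ʳ t (here refl)))) (letter (∈ₚ.∈-++⁺ʳ s d∈)) c⊏x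
      ... | inj₁ refl = contradiction c⊏x (⊑⇒¬⊐ (All.lookup (All.lookup s⊑tx x∈s) d∈))
      ... | inj₂ d≡x  = d≡x

    cases : SortedForm (s ++ t ∷ʳ x)
    cases with all? (⊏._<? x) s
    ... | yes s⊏x = viaBBWT s⊏x
    ... | no ¬s⊏x with find (Allₚ.¬All⇒Any¬ (⊏._<? x) s ¬s⊏x)
    -- The letter is bounded by `x` without being smaller, hence it is `x`.
    ...   | c , c∈s , c⊏̸x with All.lookup s⊑x c∈s
    ...     | inj₁ c⊏x  = contradiction c⊏x c⊏̸x
    ...     | inj₂ refl = repeated adm c∈s

  -- Parikh vectors and the common sorted form.

  letterOrder : TotalOrder 0ℓ 0ℓ 0ℓ
  letterOrder = DecTotalOrder.totalOrder (STOₚ.decTotalOrder strictTotalOrder)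

  sorted-unique : ∀ {v w} → AllPairs _⊑_ v → AllPairs _⊑_ w → v ↭ w → v ≡ w
  sorted-unique v↗ w↗ v↭w = Pointwise.Pointwise-≡⇒≡ (Sortedₚ.↗↭↗⇒≋ letterOrder
    (Sortedₚ.AllPairs⇒Sorted letterOrder v↗) (Sortedₚ.AllPairs⇒Sorted letterOrder w↗) (↭⇒↭ₛ v↭w))

  count-↭ : ∀ {v w} → v ↭ w → SameParikh v w
  count-↭ v↭w a = ↭ₚ.↭-length (↭ₚ.filter-↭ (⊏._≟ a) v↭w)

  count-∷-injective : ∀ c {v w} → SameParikh (c ∷ v) (c ∷ w) → SameParikh v w
  count-∷-injective c {v} {w} same a with c ⊏.≟ a | same a
  ... | yes _ | eq = ℕₚ.suc-injective eq
  ... | no  _ | eq = eq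

  count⇒∈ : ∀ a w {k} → count a w ≡ suc k → a ∈ w
  count⇒∈ a w eq with filter (⊏._≟ a) w in filter≡
  ... | c ∷ cs with ∈ₚ.∈-filter⁻ (⊏._≟ a) {xs = w} (subst (c ∈_) (sym filter≡) (here refl))
  ...   | c∈w , refl = c∈w

  sameParikh⇒↭ : ∀ u v → SameParikh u v → u ↭ v
  sameParikh⇒↭ [] []      same = ↭-refl
  sameParikh⇒↭ [] (c ∷ v) same = contradiction
    (trans (same c) (cong length (Listₚ.filter-accept (⊏._≟ c) {xs = v} refl))) λ ()
  sameParikh⇒↭ (c ∷ u) v  same
    with ∈ₚ.∈-∃++ (count⇒∈ c v (trans (sym (same c)) (cong length (Listₚ.filter-accept (⊏._≟ c) {xs = u} refl))))
  ... | v₁ , v₂ , refl = ↭-trans (prep c (sameParikh⇒↭ u (v₁ ++ v₂) (count-∷-injective c λ a →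
    trans (same a) (count-↭ (↭ₚ.shift c v₁ v₂) a)))) (↭-sym (↭ₚ.shift c v₁ v₂))

theorem4 : (A : Set) (_⊏_ : Rel A 0ℓ) (sto : IsStrictTotalOrder _≡_ _⊏_)
    (u v : List A) →
    length u ≡ length v →
    Words.SameParikh A _⊏_ sto u v →
    (Unique u ⊎ ∃₂ λ a b → All (λ c → c ≡ a ⊎ c ≡ b) u × All (λ c → c ≡ a ⊎ c ≡ b) v) →
    Words.Reachable A _⊏_ sto u v
-- Starting from the empty prefix, both words are joined to sorted rearrangements, which coincide;
-- symmetry allows going down from `u` and back up to `v`.
theorem4 A _⊏_ sto u v _ same admissible
  with sortedForm (length u) [] u refl admissible-u [] [] | sortedForm (length v) [] v refl (admissible-↭ u↭v admissible-u) [] []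
  where
  open Reach A _⊏_ sto
  u↭v : u ↭ v
  u↭v = sameParikh⇒↭ u v same
  admissible-u : Admissible u
  admissible-u = Sum.map₂ (λ (a , b , all-u , _) → a , b , all-u) admissible
... | u′ , u′↗ , u′↭u , _ , u⇝u′ | v′ , v′↗ , v′↭v , v′⇝v , _ =
  u⇝u′ ◅◅ subst (λ w → Words.Reachable A _⊏_ sto w v) (sym u′≡v′) v′⇝v
  where
  open Reach A _⊏_ sto
  u′≡v′ : u′ ≡ v′
  u′≡v′ = sorted-unique u′↗ v′↗ (↭-trans u′↭u (↭-trans (sameParikh⇒↭ u v same) (↭-sym v′↭v)))
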